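{- $V_c(0)=3$, and this supremum is not attained by any graph. For every $g \ge 1$, $V_c(g)$ is attained (there is a generalized graph cellularly embedded in $\Sigma_g$ with a complete left walk whose reduced average valence equals $V_c(g)$) and \[ 4\left(1+\frac{1}{3g}\right)^{ -1} \le V_c(g) \le b_r(g) \le b(g) := 1+\sqrt{1+6g}, \] where \[ b_r(g) := \max\left\{ \lfloor S_0(g)\rfloor_0 - 1,\ \lfloor S_1(g)\rfloor_1 - 1,\ 3+\frac{6g-4}{\lceil S_0(g)\rceil_0},\ 3+\frac{6g-3}{\lceil S_1(g)\rceil_1}\right\}, \quad S_j(g):=2+\sqrt{6g+j}\ (j=0,1). \]
   Context: Graphs are finite and connected, loops and multiple edges allowed ("generalized"); ordinary means no loops and no multiple edges. For a graph $G$, $S$ is the number of vertices and $A$ the number of edges. A graph embedded in an oriented surface inherits a polarization: at each vertex, the oriented edges based there (a loop gives two) are cyclically ordered counterclockwise. This defines a permutation $\tau$ of oriented edges: for $(o,p)$ arriving at $p$, $\tau(o,p)=(p,q)$ where $(p,q)$ immediately follows $(p,o)$ in the cyclic order at $p$. Orbits of $\tau$ are left walks; a left walk is complete if it traverses every unoriented edge at least once. An embedding $G\subset\Sigma$ is cellular if $\Sigma\setminus G$ is a disjoint union of open 2-cells; $\Sigma_g$ is the closed oriented surface of genus $g$. A reduced subgraph $G_r$ of $G$ has the same vertices, no loops, and exactly one edge of $G$ between any two distinct vertices joined by at least one edge in $G$; $A_r(G)$ is its number of edges and the reduced average valence is $V_r(G)=2A_r(G)/S$. $V_c(g)$ is the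 supremum of $V_r(G)$ over generalized graphs $G$ cellularly embedded in $\Sigma_g$ that have a complete left walk for the induced polarization. For real $x$, $\lceil x\rceil_0$ and $\lceil x\rceil_1$ are the smallest even and odd integers $\ge x$, and $\lfloor x\rfloor_0$, $\lfloor x\rfloor_1$ are the largest even and odd integers $\le x$. -}

module Defs where

open import Data.Nat as ℕ using (ℕ; zero; suc; _+_; _*_; _∸_; _%_; NonZero)
import Data.Nat.Properties as ℕP
open import Data.Integer as ℤ using (ℤ; +_)
open import Data.Rational as ℚ using (ℚ; _/_)
open import Data.Fin as Fin using (Fin)
import Data.Fin.Properties as FinP
open import Data.Bool using (Bool; true; false; not; if_then_else_)
open import Data.Product using (Σ; ∃; ∃-syntax; _×_; _,_; proj₁; proj₂)
open import Data.Product.Properties using (≡-dec)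
open import Data.Sum using (_⊎_; inj₁; inj₂)
open import Data.List using (List; length; filter; cartesianProduct; allFin)
open import Relation.Nullary using (Dec; does; _×-dec_; _⊎-dec_)
open import Relation.Binary.PropositionalEquality using (_≡_)
open import Function.Definitions using (Bijective; Surjective)
open import Function.Bundles using (_⇔_)

iter : ∀ {X : Set} → ℕ → (X → X) → X → X
iter zero    f x = x
iter (suc k) f x = f (iter k f x)

-- Oriented edges ("darts") of a graph with A edges:
-- (e , true) is e oriented from proj₁ (ends e) to proj₂ (ends e),
-- (e , false) is the opposite orientation.  A loop gives two darts.

Dart : ℕ → Set
Dart A = Fin A × Bool

rev : ∀ {A} → Dart A → Dart A
rev (e , b) = (e , not b)

data Reach {S A : ℕ} (ends : Fin A → Fin S × Fin S) (u : Fin S) : Fin S → Set where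
  here : Reach ends u u
  fwd  : ∀ {v} (e : Fin A) → Reach ends u v → proj₁ (ends e) ≡ v → Reach ends u (proj₂ (ends e))
  bwd  : ∀ {v} (e : Fin A) → Reach ends u v → proj₂ (ends e) ≡ v → Reach ends u (proj₁ (ends e))

tailOf : ∀ {S A} → (Fin A → Fin S × Fin S) → Dart A → Fin S
tailOf ends (e , true)  = proj₁ (ends e)
tailOf ends (e , false) = proj₂ (ends e)

-- A finite connected generalized graph (vertices Fin S, edges Fin A,
-- loops and multiple edges allowed) together with a polarization:
-- a permutation σ of the darts whose cycles are exactly the sets of
-- darts based at each vertex (σ d = next dart counterclockwise).

record PolGraph : Set where
  field
    S A     : ℕ
    S-nz    : NonZero S
    ends    : Fin A → Fin S × Fin S
    connected : ∀ u v → Reach ends u v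
    σ       : Dart A → Dart A
    σ-bij   : Bijective _≡_ _≡_ σ

    σ-cycles : ∀ d d' → (tailOf ends d ≡ tailOf ends d') ⇔ (∃[ k ] iter k σ d ≡ d')

  -- τ(o,p) = (p,q), where (p,q) immediately follows (p,o) at p.
  τ : Dart A → Dart A
  τ d = σ (rev d)

open PolGraph public

-- The polarized graph is a cellular embedding in Σ_g: with F the number
-- of orbits of τ (faces), Euler's formula S - A + F = 2 - 2g holds.
CellularGenus : PolGraph → ℕ → Set
CellularGenus G g =
  Σ ℕ λ F → Σ (Dart (A G) → Fin F) λ face →
    Surjective _≡_ _≡_ face
    × (∀ d d' → (face d ≡ face d') ⇔ (∃[ k ] iter k (τ G) d ≡ d'))
    × (S G + F + 2 * g ≡ A G + 2)

HasCompleteLeftWalk : PolGraph → Set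
HasCompleteLeftWalk G =
  ∃[ d ] ∀ (e : Fin (A G)) → ∃[ k ] proj₁ (iter k (τ G) d) ≡ e

Adj : (G : PolGraph) → Fin (S G) → Fin (S G) → Set
Adj G u v = ∃[ e ] (ends G e ≡ (u , v) ⊎ ends G e ≡ (v , u))

adj? : (G : PolGraph) → ∀ u v → Dec (Adj G u v)
adj? G u v = FinP.any? λ e →
  ≡-dec FinP._≟_ FinP._≟_ (ends G e) (u , v) ⊎-dec ≡-dec FinP._≟_ FinP._≟_ (ends G e) (v , u)

Ar : PolGraph → ℕ
Ar G = length (filter (λ p → (proj₁ p FinP.<? proj₂ p) ×-dec adj? G (proj₁ p) (proj₂ p))
                      (cartesianProduct (allFin (S G)) (allFin (S G))))

Vr : PolGraph → ℚ
Vr G = _/_ (+ (2 * Ar G)) (S G) {{S-nz G}}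

-- V is a valid graph in the supremum defining V_c(g).
Admissible : ℕ → PolGraph → Set
Admissible g G = CellularGenus G g × HasCompleteLeftWalk G

isqrt : ℕ → ℕ
isqrt zero    = zero
isqrt (suc m) = isqrt-step (isqrt m) (suc m)
  where
  isqrt-step : ℕ → ℕ → ℕ
  isqrt-step r n = if does (suc r * suc r ℕ.≤? n) then suc r else r

csqrt : ℕ → ℕ
csqrt m = if does (isqrt m * isqrt m ℕ.≟ m) then isqrt m else suc (isqrt m)

-- floorPar j m = ⌊ 2 + √m ⌋_j, the largest integer ≡ j (mod 2) that is ≤ 2 + √m
-- (j = 0: even, j = 1: odd).
floorPar : ℕ → ℕ → ℕ
floorPar j m = if does ((2 + isqrt m) % 2 ℕ.≟ j) then 2 + isqrt m else 1 + isqrt m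

-- ceilPar j m = ⌈ 2 + √m ⌉_j, the smallest integer ≡ j (mod 2) that is ≥ 2 + √m
-- (written as suc _ so that it is visibly nonzero).
ceilPar : ℕ → ℕ → ℕ
ceilPar j m = suc (if does ((2 + csqrt m) % 2 ℕ.≟ j) then 1 + csqrt m else 2 + csqrt m)

-- b_r(g) = max { ⌊S₀⌋₀ - 1, ⌊S₁⌋₁ - 1, 3 + (6g-4)/⌈S₀⌉₀, 3 + (6g-3)/⌈S₁⌉₁ },
-- S_j(g) = 2 + √(6g + j)  (for g ≥ 1, so 6g - 4 and 6g - 3 are ≥ 0).
br : ℕ → ℚ
br g = ((+ (floorPar 0 (6 * g)) / 1) ℚ.- ℚ.1ℚ)
       ℚ.⊔ ((+ (floorPar 1 (6 * g + 1)) / 1) ℚ.- ℚ.1ℚ)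
       ℚ.⊔ ((+ 3 / 1) ℚ.+ (+ (6 * g ∸ 4) / ceilPar 0 (6 * g)))
       ℚ.⊔ ((+ 3 / 1) ℚ.+ (+ (6 * g ∸ 3) / ceilPar 1 (6 * g + 1)))

-- q ≤ √r  (for r ≥ 0): either q ≤ 0, or q² ≤ r.
_≤√_ : ℚ → ℚ → Set
q ≤√ r = q ℚ.≤ ℚ.0ℚ ⊎ q ℚ.* q ℚ.≤ r

LeB : ℚ → ℕ → Set
LeB q g = (q ℚ.- ℚ.1ℚ) ≤√ (+ (1 + 6 * g) / 1)

-- Upper bound.  Let O be the complete left walk.  Every edge lies on O, so it lies on at most one
-- other face; if the other faces have at least 3 sides then 3 (F - 1) ≤ A, and Euler's formula
-- turns this into 2 A + 3 ≤ 3 S + 6 g.  A face other than O with 1 or 2 sides is removed by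
-- deleting one of its edges, which merges it with O and changes neither g nor the reduced graph.
-- The same deletion bounds A in terms of S and g.
--
-- Lower bound.  Glue copies of a small map at a common vertex, merging their complete
-- left walks: triangles give valences tending to 3 on the sphere, and g wheels on 4 rim vertices
-- give 16 g / (4 g + 1) ≥ 12 g / (3 g + 1) in genus g.
--
-- Attainment.  The last value exceeds 3 while all valences are at most 3 + (6 g - 3) / S, so only
-- finitely many pairs (S , A) can compete, and for each of them the maps can be enumerated.
module Submission where

open import Defs
open import Data.Nat as ℕ using (ℕ; zero; suc; _+_; _*_; _^_; _≤_; _∸_; _%_; NonZero)
import Data.Nat.Properties as ℕP
import Data.Nat.DivMod as DivMod
open import Data.Nat.Induction using (<-rec)
open import Data.Nat.Tactic.RingSolver using (solve-∀; solve)
open import Data.Integer as ℤ using (ℤ; +_; -[1+_])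
import Data.Integer.Properties as ℤP
open import Data.Rational as ℚ using (ℚ; mkℚ; toℚᵘ; _/_; _<_) renaming (_≤_ to _≤ℚ_)
import Data.Rational.Properties as ℚP
open import Data.Rational.Unnormalised as ℚᵘ using (mkℚᵘ; *≤*; *<*)
import Data.Rational.Unnormalised.Properties as ℚᵘP
open import Data.Bool using (Bool; true; false; not; if_then_else_)
import Data.Bool.Properties as BoolP
open import Data.Fin as Fin using (Fin; zero; suc; #_; toℕ; funToFin; finToFun)
import Data.Fin.Properties as FinP
open import Data.Product using (Σ; ∃; ∃-syntax; _×_; _,_; proj₁; proj₂; uncurry)
open import Data.Product.Properties using (,-injective; ≡-dec)
open import Data.Sum as Sum using (_⊎_; inj₁; inj₂)
import Data.Sum.Properties as SumP
open import Data.Sum.Properties using (inj₁-injective; inj₂-injective)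
open import Data.Empty using (⊥; ⊥-elim)
open import Data.Vec as Vec using (Vec)
open import Data.List using (List; []; _∷_; length; filter; lookup; cartesianProduct; allFin; concat; tabulate)
open import Data.List.Membership.Propositional using (_∈_)
open import Data.List.Membership.Propositional.Properties
  using (∈-lookup; ∈-filter⁺; ∈-filter⁻; ∈-cartesianProduct⁺; ∈-allFin)
open import Data.List.Relation.Unary.Any as Any using (Any; here)
import Data.List.Relation.Unary.Any.Properties as AnyP
import Data.List.Relation.Unary.All as All
import Data.List.Relation.Unary.AllPairs as AllPairs
open import Data.List.Relation.Unary.Unique.Propositional using (Unique)
import Data.List.Relation.Unary.Unique.Propositional.Properties as Unique
open import Relation.Binary.Bundles using (DecTotalOrder)
open import Data.List.Extrema (DecTotalOrder.totalOrder ℚP.≤-decTotalOrder) using (argmax; v≤f[argmax]⁺; f[⊥]≤f[argmax])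
open import Function using (_∘_)
open import Function.Definitions using (Bijective; Injective)
open import Function.Bundles using (_⇔_; mk⇔; Equivalence; Inverse)
open import Relation.Nullary using (¬_; Dec; yes; no; does; contradiction; ¬?; _×-dec_; _⊎-dec_; _→-dec_)
open import Relation.Nullary.Decidable using (map′; from-yes)
open import Relation.Unary using (Decidable)
open import Relation.Binary.Definitions using (DecidableEquality; tri<; tri≈; tri>)
open import Relation.Binary.PropositionalEquality

-- Orbits

-- No surface is ever built: vertices and faces are only labels of the orbits of two permutations of
-- the darts, `next` and `next ∘ rev`. Deletion and gluing rest on one fact: exchanging the images
-- of two points in different orbits joins these orbits and leaves the others alone. In a one-point
-- union, exchanging the images of two darts under `next` joins two vertices, and the same exchange
-- seen through `rev` joins the two outer faces. In a deletion, exchanging the images of a dart and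
-- its reverse under the left walk joins an inner face to the outer one; both darts are then cut out
-- of their orbits. The valence obeys two bounds: S - 1, as the reduced graph is ordinary, and 3 +
-- n/S from Euler's formula, where n = 6g - 3, improved to 6g - 4 by parity when S is even. For g ≥
-- 1 the first increases with S and the second decreases; they cross where (S - 2)^2 = n + 4, that
-- is at S = 2 + √(6g + 1) or S = 2 + √(6g). Rounding these points down and up to the parity of S
-- gives the four terms of `br`.

iter-suc : ∀ {X : Set} (f : X → X) k x → iter (suc k) f x ≡ iter k f (f x)
iter-suc f zero    x = refl
iter-suc f (suc k) x = cong f (iter-suc f k x)

iter-+ : ∀ {X : Set} (f : X → X) k l x → iter (k + l) f x ≡ iter k f (iter l f x)
iter-+ f zero    l x = refl
iter-+ f (suc k) l x = cong f (iter-+ f k l x)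

iter-cong : ∀ {X : Set} {f g : X → X} → (∀ x → f x ≡ g x) → ∀ k x → iter k f x ≡ iter k g x
iter-cong f≗g zero    x = refl
iter-cong {f = f} f≗g (suc k) x = trans (cong f (iter-cong f≗g k x)) (f≗g _)

iter-period : ∀ {X : Set} (f : X → X) {n x} → iter n f x ≡ x → ∀ m → iter (m * n) f x ≡ x
iter-period f         p zero    = refl
iter-period f {n} {x} p (suc m) =
  trans (iter-+ f n (m * n) x) (trans (cong (iter n f) (iter-period f p m)) p)

Reaches : ∀ {X : Set} (f : X → X) → X → X → Set
Reaches f x y = ∃[ k ] iter k f x ≡ y

module _ {X : Set} {f : X → X} where

  reaches-refl : ∀ {x} → Reaches f x x
  reaches-refl = 0 , refl

  reaches-trans : ∀ {x y z} → Reaches f x y → Reaches f y z → Reaches f x z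
  reaches-trans {x} (k , refl) (l , refl) = l + k , iter-+ f l k x

  reaches-cons : ∀ {x y} → Reaches f (f x) y → Reaches f x y
  reaches-cons {x} (k , p) = suc k , trans (iter-suc f k x) p

record IsOrbitLabelling {X Y : Set} (f : X → X) (ℓ : X → Y) : Set where
  field
    invariant  : ∀ x → ℓ (f x) ≡ ℓ x
    transitive : ∀ {x y} → ℓ x ≡ ℓ y → Reaches f x y

  iter-invariant : ∀ k x → ℓ (iter k f x) ≡ ℓ x
  iter-invariant zero    x = refl
  iter-invariant (suc k) x = trans (invariant _) (iter-invariant k x)

  label⇔reaches : ∀ x y → (ℓ x ≡ ℓ y) ⇔ Reaches f x y
  label⇔reaches x y = mk⇔ transitive λ { (k , refl) → sym (iter-invariant k x) }

  -- `invariant` and `transitive` together bring `f x` back to `x`, so every point is periodic. The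
  -- product of the periods of `x` and `y` is a common period, and the iterations left after the
  -- first step recover both points from `f x ≡ f y`.
  injective : Injective _≡_ _≡_ f
  injective {x} {y} fx≡fy = begin
    x                       ≡⟨ ret₁ ⟨
    iter (suc j * suc i) f x    ≡⟨ step x ⟩
    iter (i + j * suc i) f (f x) ≡⟨ cong (iter (i + j * suc i) f) fx≡fy ⟩
    iter (i + j * suc i) f (f y) ≡⟨ step y ⟨
    iter (suc j * suc i) f y    ≡⟨ cong (λ n → iter n f y) (ℕP.*-comm (suc j) (suc i)) ⟩
    iter (suc i * suc j) f y    ≡⟨ ret₂ ⟩
    y ∎
    where
    open ≡-Reasoning
    i = proj₁ (transitive (invariant x))
    j = proj₁ (transitive (invariant y))
    ret₁ : iter (suc j * suc i) f x ≡ x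
    ret₁ = iter-period f {suc i} (trans (iter-suc f i x) (proj₂ (transitive (invariant x)))) (suc j)
    ret₂ : iter (suc i * suc j) f y ≡ y
    ret₂ = iter-period f {suc j} (trans (iter-suc f j y) (proj₂ (transitive (invariant y)))) (suc i)
    step : ∀ z → iter (suc j * suc i) f z ≡ iter (i + j * suc i) f (f z)
    step z = iter-suc f (i + j * suc i) z

  bijective : Bijective _≡_ _≡_ f
  bijective = injective , surjective
    where
    surjective : ∀ y → ∃ λ x → ∀ {z} → z ≡ x → f z ≡ y
    surjective y with k , p ← transitive (invariant y) =
      iter k f y , λ { refl → trans (iter-suc f k y) p }

open IsOrbitLabelling

fromLabel⇔Reaches : ∀ {X Y : Set} {f : X → X} {ℓ : X → Y} →
  (∀ x y → (ℓ x ≡ ℓ y) ⇔ Reaches f x y) → IsOrbitLabelling f ℓ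
fromLabel⇔Reaches h = record
  { invariant  = λ x → sym (Equivalence.from (h x _) (1 , refl))
  ; transitive = Equivalence.to (h _ _)
  }

orbitLabelling-cong : ∀ {X Y : Set} {f g : X → X} {ℓ m : X → Y} →
  (∀ x → f x ≡ g x) → (∀ x → ℓ x ≡ m x) → IsOrbitLabelling f ℓ → IsOrbitLabelling g m
orbitLabelling-cong {g = g} {m = m} f≗g ℓ≗m O = record
  { invariant  = λ x → trans (cong m (sym (f≗g x)))
                         (trans (sym (ℓ≗m _)) (trans (invariant O x) (ℓ≗m x)))
  ; transitive = λ {x} {y} p →
      let k , q = transitive O (trans (ℓ≗m x) (trans p (sym (ℓ≗m y))))
      in k , trans (sym (iter-cong f≗g k x)) q
  }

-- f′ is f precomposed with the transposition of x and y, which lie in different orbits: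
-- the two orbits become one.
module MergeOrbits
  {X Y Z : Set} {f : X → X} {ℓ : X → Y} (O : IsOrbitLabelling f ℓ)
  (_≟X_ : DecidableEquality X) (_≟Y_ : DecidableEquality Y)
  {x y : X} (ℓx≢ℓy : ℓ x ≢ ℓ y)
  {f′ : X → X} (f′x : f′ x ≡ f y) (f′y : f′ y ≡ f x)
  (f′-else : ∀ z → z ≢ x → z ≢ y → f′ z ≡ f z)
  (m : Y → Z) (mx≡my : m (ℓ x) ≡ m (ℓ y))
  (m-injective : ∀ u v → m u ≡ m v →
     u ≡ v ⊎ ((u ≡ ℓ x ⊎ u ≡ ℓ y) × (v ≡ ℓ x ⊎ v ≡ ℓ y)))
  where

  private
    avoid : ∀ {a b} → ℓ a ≢ ℓ b → a ≢ b
    avoid h refl = h refl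

    via : ∀ {a b c} → f′ a ≡ b → Reaches f′ b c → Reaches f′ a c
    via {c = c} p r = reaches-cons (subst (λ b → Reaches f′ b c) (sym p) r)

    -- Up to the first visit to `x`, the maps `f` and `f′` agree along the orbit of `x`: the only
    -- other point where they may differ is `y`, which carries another label.
    to-x : ∀ k a → ℓ a ≡ ℓ x → iter k f a ≡ x → Reaches f′ a x
    to-x zero    a e p = 0 , p
    to-x (suc k) a e p with a ≟X x
    ... | yes refl = reaches-refl
    ... | no a≢x = via (f′-else a a≢x (avoid λ q → ℓx≢ℓy (trans (sym e) q)))
                     (to-x k (f a) (trans (invariant O a) e) (trans (sym (iter-suc f k a)) p))

    to-y : ∀ k a → ℓ a ≡ ℓ y → iter k f a ≡ y → Reaches f′ a y
    to-y zero    a e p = 0 , p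
    to-y (suc k) a e p with a ≟X y
    ... | yes refl = reaches-refl
    ... | no a≢y = via (f′-else a (avoid λ q → ℓx≢ℓy (trans (sym q) e)) a≢y)
                     (to-y k (f a) (trans (invariant O a) e) (trans (sym (iter-suc f k a)) p))

    reach-x : ∀ {a} → ℓ a ≡ ℓ x → Reaches f′ a x
    reach-x e = let k , p = transitive O e in to-x k _ e p

    reach-y : ∀ {a} → ℓ a ≡ ℓ y → Reaches f′ a y
    reach-y e = let k , p = transitive O e in to-y k _ e p

    x⇝y : Reaches f′ x y
    x⇝y = via f′x (reach-y (invariant O y))

    y⇝x : Reaches f′ y x
    y⇝x = via f′y (reach-x (invariant O x))

    snoc : ∀ {a b c} → Reaches f′ a b → f′ b ≡ c → Reaches f′ a c
    snoc r p = reaches-trans r (via p reaches-refl)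

    from-x : ∀ k → Reaches f′ x (iter k f x)
    from-x zero    = reaches-refl
    from-x (suc k) with iter k f x ≟X x
    ... | yes p = snoc x⇝y (trans f′y (cong f (sym p)))
    ... | no ≢x = snoc (from-x k)
                    (f′-else _ ≢x (avoid λ q → ℓx≢ℓy (trans (sym (iter-invariant O k x)) q)))

    from-y : ∀ k → Reaches f′ y (iter k f y)
    from-y zero    = reaches-refl
    from-y (suc k) with iter k f y ≟X y
    ... | yes p = snoc y⇝x (trans f′x (cong f (sym p)))
    ... | no ≢y = snoc (from-y k)
                    (f′-else _ (avoid λ q → ℓx≢ℓy (trans (sym q) (iter-invariant O k y))) ≢y)

    hub⇝ : ∀ {b} → ℓ b ≡ ℓ x ⊎ ℓ b ≡ ℓ y → Reaches f′ x b
    hub⇝ (inj₁ e) with k , p ← transitive O (sym e) = subst (Reaches f′ x) p (from-x k)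
    hub⇝ (inj₂ e) with k , p ← transitive O (sym e) =
      reaches-trans x⇝y (subst (Reaches f′ y) p (from-y k))

    ⇝hub : ∀ {a} → ℓ a ≡ ℓ x ⊎ ℓ a ≡ ℓ y → Reaches f′ a x
    ⇝hub (inj₁ e) = reach-x e
    ⇝hub (inj₂ e) = reaches-trans (reach-y e) y⇝x

    outside : ∀ k a → ℓ a ≢ ℓ x → ℓ a ≢ ℓ y → Reaches f′ a (iter k f a)
    outside zero    a _  _  = reaches-refl
    outside (suc k) a ≢x ≢y = snoc (outside k a ≢x ≢y)
      (f′-else _ (avoid λ q → ≢x (trans (sym (iter-invariant O k a)) q))
                 (avoid λ q → ≢y (trans (sym (iter-invariant O k a)) q)))

    same-label : ∀ {a b} → ℓ a ≡ ℓ b → Reaches f′ a b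
    same-label {a} e with ℓ a ≟Y ℓ x | ℓ a ≟Y ℓ y
    ... | yes p | _     = reaches-trans (⇝hub (inj₁ p)) (hub⇝ (inj₁ (trans (sym e) p)))
    ... | no _  | yes p = reaches-trans (⇝hub (inj₂ p)) (hub⇝ (inj₂ (trans (sym e) p)))
    ... | no ≢x | no ≢y with k , p ← transitive O e =
      subst (Reaches f′ a) p (outside k a ≢x ≢y)

    merged-invariant : ∀ z → m (ℓ (f′ z)) ≡ m (ℓ z)
    merged-invariant z with z ≟X x | z ≟X y
    ... | yes refl | _ = trans (cong (m ∘ ℓ) f′x) (trans (cong m (invariant O y)) (sym mx≡my))
    ... | no _ | yes refl = trans (cong (m ∘ ℓ) f′y) (trans (cong m (invariant O x)) mx≡my)
    ... | no ≢x | no ≢y = cong m (trans (cong ℓ (f′-else z ≢x ≢y)) (invariant O z))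

  merged : IsOrbitLabelling f′ (m ∘ ℓ)
  merged = record
    { invariant  = merged-invariant
    ; transitive = λ {a} {b} p → connect (m-injective (ℓ a) (ℓ b) p)
    }
    where
    connect : ∀ {a b} → ℓ a ≡ ℓ b ⊎ ((ℓ a ≡ ℓ x ⊎ ℓ a ≡ ℓ y) × (ℓ b ≡ ℓ x ⊎ ℓ b ≡ ℓ y)) →
              Reaches f′ a b
    connect (inj₁ e)       = same-label e
    connect (inj₂ (p , q)) = reaches-trans (⇝hub p) (hub⇝ q)

-- FirstHit f P i x b: the first point of x, f x, f (f x), … that avoids P is i b.
data FirstHit {X X′ : Set} (f : X → X) (P : X → Set) (i : X′ → X) : X → X′ → Set where
  hit  : ∀ {x b} → x ≡ i b → FirstHit f P i x b
  skip : ∀ {x b} → P x → FirstHit f P i (f x) b → FirstHit f P i x b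

module _ {X X′ : Set} {P : X → Set} {i : X′ → X} where

  firstHit-map : ∀ {f g : X → X} → (∀ x → P x → f x ≡ g x) →
    ∀ {x b} → FirstHit f P i x b → FirstHit g P i x b
  firstHit-map h (hit p) = hit p
  firstHit-map {g = g} h (skip {b = b} p r) =
    skip p (subst (λ z → FirstHit g P i z b) (h _ p) (firstHit-map h r))

  -- The number `k` is fuel: the orbit is known to arrive at the kept point `i a`, so skipping stops
  -- there at the latest.
  firstHit-exists : ∀ {f : X → X} → (∀ x → P x ⊎ ∃ λ b → x ≡ i b) → (∀ b → ¬ P (i b)) →
    ∀ k x a → iter k f x ≡ i a → ∃ λ b → FirstHit f P i x b
  firstHit-exists split i∉P k x a p with split x
  ... | inj₂ (b , q) = b , hit q
  firstHit-exists split i∉P zero    x a p | inj₁ q = ⊥-elim (i∉P a (subst P p q))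
  firstHit-exists {f} split i∉P (suc k) x a p | inj₁ q
    with b , h ← firstHit-exists split i∉P k (f x) a (trans (sym (iter-suc f k x)) p) =
    b , skip q h

  -- The first-return map to the complement of P cuts out P from every orbit.
  restrict : ∀ {Y : Set} {f : X → X} {ℓ : X → Y} {f′ : X′ → X′} → IsOrbitLabelling f ℓ →
    (∀ {a b} → i a ≡ i b → a ≡ b) → (∀ b → ¬ P (i b)) →
    (∀ a → FirstHit f P i (f (i a)) (f′ a)) → IsOrbitLabelling f′ (ℓ ∘ i)
  restrict {f = f} {ℓ} {f′} O i-inj i∉P ret = record
    { invariant  = λ a → trans (hit-label (ret a)) (invariant O (i a))
    ; transitive = λ e → let k , p = transitive O e in walk k _ (hit refl) p
    }
    where
    hit-label : ∀ {x b} → FirstHit f P i x b → ℓ (i b) ≡ ℓ x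
    hit-label (hit refl)  = refl
    hit-label (skip _ h)  = trans (hit-label h) (invariant O _)

    walk : ∀ k x {b c} → FirstHit f P i x b → iter k f x ≡ i c → Reaches f′ b c
    walk zero    x (hit p)    q = 0 , i-inj (trans (sym p) q)
    walk zero    x (skip p _) q = ⊥-elim (i∉P _ (subst P q p))
    walk (suc k) x {b} (hit refl) q =
      reaches-cons (walk k (f x) (ret b) (trans (sym (iter-suc f k x)) q))
    walk (suc k) x (skip _ h) q = walk k (f x) h (trans (sym (iter-suc f k x)) q)

transport-labelling : ∀ {X X′ Y : Set} {f : X → X} {ℓ : X → Y} {f′ : X′ → X′} {i : X′ → X} →
  IsOrbitLabelling f ℓ → (∀ {a b} → i a ≡ i b → a ≡ b) → (∀ a → i (f′ a) ≡ f (i a)) →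
  IsOrbitLabelling f′ (ℓ ∘ i)
transport-labelling {i = i} O i-inj eq =
  restrict {P = λ _ → ⊥} O i-inj (λ _ ()) (λ a → hit (sym (eq a)))

sum-labelling : ∀ {X₁ X₂ Y₁ Y₂ : Set} {f₁ : X₁ → X₁} {f₂ : X₂ → X₂} {ℓ₁ : X₁ → Y₁} {ℓ₂ : X₂ → Y₂} →
  IsOrbitLabelling f₁ ℓ₁ → IsOrbitLabelling f₂ ℓ₂ →
  IsOrbitLabelling (Sum.map f₁ f₂) (Sum.map ℓ₁ ℓ₂)
sum-labelling {f₁ = f₁} {f₂} {ℓ₁} {ℓ₂} O₁ O₂ = record
  { invariant = λ { (inj₁ x) → cong inj₁ (invariant O₁ x) ; (inj₂ x) → cong inj₂ (invariant O₂ x) }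
  ; transitive = λ {x} {y} → trs x y
  }
  where
  iter₁ : ∀ k x → iter k (Sum.map f₁ f₂) (inj₁ x) ≡ inj₁ (iter k f₁ x)
  iter₁ zero    x = refl
  iter₁ (suc k) x = cong (Sum.map f₁ f₂) (iter₁ k x)

  iter₂ : ∀ k x → iter k (Sum.map f₁ f₂) (inj₂ x) ≡ inj₂ (iter k f₂ x)
  iter₂ zero    x = refl
  iter₂ (suc k) x = cong (Sum.map f₁ f₂) (iter₂ k x)

  trs : ∀ x y → Sum.map ℓ₁ ℓ₂ x ≡ Sum.map ℓ₁ ℓ₂ y → Reaches (Sum.map f₁ f₂) x y
  trs (inj₁ x) (inj₁ y) e with k , p ← transitive O₁ (inj₁-injective e) = k , trans (iter₁ k x) (cong inj₁ p)
  trs (inj₂ x) (inj₂ y) e with k , p ← transitive O₂ (inj₂-injective e) = k , trans (iter₂ k x) (cong inj₂ p)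

-- Counting in finite lists and by injections

unique-lookup-injective : ∀ {X : Set} {xs : List X} → Unique xs →
  ∀ i j → lookup xs i ≡ lookup xs j → i ≡ j
unique-lookup-injective (x∉ AllPairs.∷ u) zero    zero    p = refl
unique-lookup-injective (x∉ AllPairs.∷ u) zero    (suc j) p = contradiction p (All.lookup x∉ (∈-lookup j))
unique-lookup-injective (x∉ AllPairs.∷ u) (suc i) zero    p = contradiction (sym p) (All.lookup x∉ (∈-lookup i))
unique-lookup-injective (x∉ AllPairs.∷ u) (suc i) (suc j) p = cong suc (unique-lookup-injective u i j p)

length-filter-mono : ∀ {X : Set} {P Q : X → Set} (P? : Decidable P) (Q? : Decidable Q) →
  (∀ x → P x → Q x) → ∀ xs → length (filter P? xs) ≤ length (filter Q? xs)
length-filter-mono P? Q? h [] = ℕ.z≤n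
length-filter-mono P? Q? h (x ∷ xs) with P? x | Q? x
... | yes p | yes q = ℕ.s≤s (length-filter-mono P? Q? h xs)
... | yes p | no ¬q = contradiction (h x p) ¬q
... | no _  | yes q = ℕP.m≤n⇒m≤1+n (length-filter-mono P? Q? h xs)
... | no _  | no _  = length-filter-mono P? Q? h xs

≤-fromInjection⊎ : ∀ {a b n} (h : Fin a ⊎ Fin b → Fin n) → (∀ x y → h x ≡ h y → x ≡ y) → a + b ≤ n
≤-fromInjection⊎ {a} {b} h h-inj = FinP.injective⇒≤ {f = h ∘ Fin.splitAt a}
  λ {x} {y} p → trans (sym (FinP.join-splitAt a b x))
    (trans (cong (Fin.join a b) (h-inj _ _ p)) (FinP.join-splitAt a b y))

-- Number of edges of the reduced graph

module ReducedEdges (G : PolGraph) where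

  private
    V : Set
    V = Fin (S G)

  IsReducedEdge : V × V → Set
  IsReducedEdge (u , v) = u Fin.< v × Adj G u v

  reducedEdges : List (V × V)
  reducedEdges = filter (λ p → (proj₁ p FinP.<? proj₂ p) ×-dec adj? G (proj₁ p) (proj₂ p))
                   (cartesianProduct (allFin (S G)) (allFin (S G)))

  reducedEdges-unique : Unique reducedEdges
  reducedEdges-unique = Unique.filter⁺ _ (Unique.cartesianProduct⁺ (Unique.allFin⁺ _) (Unique.allFin⁺ _))

  edge : Fin (Ar G) → V × V
  edge = lookup reducedEdges

  edge-injective : ∀ i j → edge i ≡ edge j → i ≡ j
  edge-injective = unique-lookup-injective reducedEdges-unique

  edge-valid : ∀ i → IsReducedEdge (edge i)
  edge-valid i = proj₂ (∈-filter⁻ _ {xs = cartesianProduct (allFin (S G)) (allFin (S G))}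
                          (∈-lookup {xs = reducedEdges} i))

  ∈-reducedEdges : ∀ {u v} → u Fin.< v → Adj G u v → (u , v) ∈ reducedEdges
  ∈-reducedEdges u<v a = ∈-filter⁺ _ (∈-cartesianProduct⁺ (∈-allFin _) (∈-allFin _)) (u<v , a)

  Ar≤A : Ar G ≤ A G
  Ar≤A = FinP.injective⇒≤ {f = λ i → proj₁ (proj₂ (edge-valid i))} λ {i} {j} p →
    edge-injective i j (same (edge-valid i) (edge-valid j) p)
    where
    same : ∀ {p q} (r : IsReducedEdge p) (s : IsReducedEdge q) → proj₁ (proj₂ r) ≡ proj₁ (proj₂ s) → p ≡ q
    same (_ , e , inj₁ r) (_ , e , inj₁ s) refl = trans (sym r) s
    same (_ , e , inj₂ r) (_ , e , inj₂ s) refl with refl , refl ← ,-injective (trans (sym r) s) = refl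
    same (u<v , e , inj₁ r) (v<u , e , inj₂ s) refl with refl , refl ← ,-injective (trans (sym r) s) =
      contradiction v<u (FinP.<-asym u<v)
    same (u<v , e , inj₂ r) (v<u , e , inj₁ s) refl with refl , refl ← ,-injective (trans (sym r) s) =
      contradiction v<u (FinP.<-asym u<v)

  -- The pairs (u , v) and (v , u) for the reduced edges, and the diagonal, are distinct.
  2Ar+S≤S² : Ar G + (Ar G + S G) ≤ S G * S G
  2Ar+S≤S² = ≤-fromInjection⊎ {Ar G} {Ar G + S G} code λ x y p → pair-injective x y (code-pair x y p)
    where
    swap : V × V → V × V
    swap (u , v) = v , u

    pair : Fin (Ar G) ⊎ Fin (Ar G + S G) → V × V
    pair (inj₁ i) = edge i
    pair (inj₂ k) with Fin.splitAt (Ar G) k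
    ... | inj₁ i = swap (edge i)
    ... | inj₂ v = v , v

    code : Fin (Ar G) ⊎ Fin (Ar G + S G) → Fin (S G * S G)
    code x = Fin.combine (proj₁ (pair x)) (proj₂ (pair x))

    code-pair : ∀ x y → code x ≡ code y → pair x ≡ pair y
    code-pair x y p = let q , r = FinP.combine-injective _ _ _ _ p in cong₂ _,_ q r

    edge≢swap : ∀ i j → edge i ≢ swap (edge j)
    edge≢swap i j p = FinP.<-asym (proj₁ (edge-valid j))
      (subst (λ e → proj₁ e Fin.< proj₂ e) p (proj₁ (edge-valid i)))

    edge≢diagonal : ∀ i v → edge i ≢ (v , v)
    edge≢diagonal i v p =
      FinP.<-irrefl refl (subst (λ e → proj₁ e Fin.< proj₂ e) p (proj₁ (edge-valid i)))

    splitAt-injective : ∀ k l → Fin.splitAt (Ar G) {S G} k ≡ Fin.splitAt (Ar G) l → k ≡ l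
    splitAt-injective k l p = trans (sym (FinP.join-splitAt (Ar G) (S G) k))
      (trans (cong (Fin.join (Ar G) (S G)) p) (FinP.join-splitAt (Ar G) (S G) l))

    pair-injective : ∀ x y → pair x ≡ pair y → x ≡ y
    pair-injective (inj₁ i) (inj₁ j) p = cong inj₁ (edge-injective i j p)
    pair-injective (inj₁ i) (inj₂ k) p with Fin.splitAt (Ar G) k
    ... | inj₁ j = contradiction p (edge≢swap i j)
    ... | inj₂ v = contradiction p (edge≢diagonal i v)
    pair-injective (inj₂ k) (inj₁ j) p with Fin.splitAt (Ar G) k
    ... | inj₁ i = contradiction (sym p) (edge≢swap j i)
    ... | inj₂ v = contradiction (sym p) (edge≢diagonal j v)
    pair-injective (inj₂ k) (inj₂ l) p
      with Fin.splitAt (Ar G) k in eqk | Fin.splitAt (Ar G) l in eql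
    ... | inj₁ i | inj₁ j = cong inj₂ (splitAt-injective k l
            (trans eqk (trans (cong inj₁ (edge-injective i j (cong swap p))) (sym eql))))
    ... | inj₁ i | inj₂ v = contradiction (cong swap p) (edge≢diagonal i v)
    ... | inj₂ v | inj₁ j = contradiction (cong swap (sym p)) (edge≢diagonal j v)
    ... | inj₂ u | inj₂ v = cong inj₂ (splitAt-injective k l
            (trans eqk (trans (cong (inj₂ ∘ proj₁) p) (sym eql))))

-- A polarized graph with a complete left walk, presented by labellings of the darts by
-- vertices and by faces.  Connectedness need not be recorded: consecutive darts of the
-- left walk `outer` share a vertex, and this walk meets every edge.
record Map (g S A F : ℕ) : Set where
  field
    tail        : Dart A → Fin S
    next        : Dart A → Dart A
    face        : Dart A → Fin F
    outer       : Fin F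
    tail-onto   : ∀ v → ∃ λ d → tail d ≡ v
    face-onto   : ∀ f → ∃ λ d → face d ≡ f
    next-orbits : IsOrbitLabelling next tail
    walk-orbits : IsOrbitLabelling (next ∘ rev) face
    complete    : ∀ e → ∃ λ b → face (e , b) ≡ outer
    euler       : S + F + 2 * g ≡ A + 2

  walk : Dart A → Dart A
  walk = next ∘ rev

  walk-tail : ∀ d → tail (walk d) ≡ tail (rev d)
  walk-tail d = invariant next-orbits (rev d)

  start : Dart A
  start = proj₁ (face-onto outer)

  start-outer : face start ≡ outer
  start-outer = proj₂ (face-onto outer)

-- Passage between maps and polarized graphs

rev-rev : ∀ {A} (d : Dart A) → rev (rev d) ≡ d
rev-rev (e , b) = cong (e ,_) (BoolP.not-involutive b)

module Reachability {S A : ℕ} (tail : Dart A → Fin S) where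

  private
    ends′ : Fin A → Fin S × Fin S
    ends′ e = tail (e , true) , tail (e , false)

  tailOf-ends : ∀ d → tail d ≡ tailOf ends′ d
  tailOf-ends (e , true)  = refl
  tailOf-ends (e , false) = refl

  reach-step : ∀ {u} d → Reach ends′ u (tail d) → Reach ends′ u (tail (rev d))
  reach-step (e , true)  r = fwd e r refl
  reach-step (e , false) r = bwd e r refl

  reach-trans : ∀ {u v w} → Reach ends′ u v → Reach ends′ v w → Reach ends′ u w
  reach-trans r here        = r
  reach-trans r (fwd e s p) = fwd e (reach-trans r s) p
  reach-trans r (bwd e s p) = bwd e (reach-trans r s) p

  reach-sym : ∀ {u v} → Reach ends′ u v → Reach ends′ v u
  reach-sym here           = here
  reach-sym (fwd e s refl) = reach-trans (bwd e here refl) (reach-sym s)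
  reach-sym (bwd e s refl) = reach-trans (fwd e here refl) (reach-sym s)

module _ {g S A F : ℕ} (M : Map g S A F) where
  open Map M
  open Reachability tail

  private
    ends′ : Fin A → Fin S × Fin S
    ends′ e = tail (e , true) , tail (e , false)

    reach-iter : ∀ k → Reach ends′ (tail start) (tail (iter k walk start))
    reach-iter zero    = here
    reach-iter (suc k) = subst (Reach ends′ _) (sym (walk-tail _)) (reach-step _ (reach-iter k))

    reach-outer : ∀ d → face d ≡ outer → Reach ends′ (tail start) (tail d)
    reach-outer d p with k , q ← transitive walk-orbits (trans start-outer (sym p)) =
      subst (Reach ends′ _ ∘ tail) q (reach-iter k)

    -- The outer walk may use the edge only in the direction opposite to `d`. It then visits the
    -- head of `d`, from which the edge leads to the tail.
    reach-dart : ∀ d → Reach ends′ (tail start) (tail d)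
    reach-dart (e , b) with b′ , p ← complete e with b BoolP.≟ b′
    ... | yes refl = reach-outer (e , b) p
    ... | no b≢b′ with refl ← BoolP.¬-not b≢b′ = reach-step (e , b′) (reach-outer (e , b′) p)

    reach-vertex : ∀ v → Reach ends′ (tail start) v
    reach-vertex v with d , refl ← tail-onto v = reach-dart d

  toPolGraph : PolGraph
  toPolGraph = record
    { S         = S
    ; A         = A
    ; S-nz      = FinP.nonZeroIndex (tail start)
    ; ends      = ends′
    ; connected = λ u v → reach-trans (reach-sym (reach-vertex u)) (reach-vertex v)
    ; σ         = next
    ; σ-bij     = bijective next-orbits
    ; σ-cycles  = label⇔reaches (orbitLabelling-cong (λ _ → refl) tailOf-ends next-orbits)
    }

  toPolGraph-admissible : Admissible g toPolGraph
  toPolGraph-admissible =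
    (F , face , (λ f → proj₁ (face-onto f) , λ { refl → proj₂ (face-onto f) })
       , label⇔reaches walk-orbits , euler)
    , start , λ e →
        let b , p = complete e
            k , q = transitive walk-orbits (trans start-outer (sym p))
        in k , cong proj₁ q

  adj-darts : ∀ d → Adj toPolGraph (tail d) (tail (rev d))
  adj-darts (e , true)  = e , inj₁ refl
  adj-darts (e , false) = e , inj₂ refl

  adj⇒dart : ∀ {u v} → Adj toPolGraph u v → ∃ λ d → tail d ≡ u × tail (rev d) ≡ v
  adj⇒dart (e , inj₁ p) = (e , true)  , ,-injective p
  adj⇒dart (e , inj₂ p) = (e , false) , proj₂ (,-injective p) , proj₁ (,-injective p)

  arMap : ℕ
  arMap = Ar toPolGraph

admissible⇒map : ∀ {g} (G : PolGraph) → Admissible g G →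
  ∃ λ F → Σ (Map g (S G) (A G) F) λ M → Ar (toPolGraph M) ≡ Ar G
-- `refl` suffices because `toPolGraph M` rebuilds each pair `ends G e` from its two components, so
-- by eta both sides count the same pairs.
admissible⇒map {g} G ((F , face , onto , orbits , eul) , d₀ , compl) = F , M , refl
  where
  walks : IsOrbitLabelling (τ G) face
  walks = fromLabel⇔Reaches orbits

  -- The last edge of a path to `v`, reversed, is a dart based at `v`. The empty path is served by
  -- `d₀`, which comes with the complete left walk.
  onto′ : ∀ v → Reach (ends G) (tailOf (ends G) d₀) v → ∃ λ d → tailOf (ends G) d ≡ v
  onto′ v here        = d₀ , refl
  onto′ v (fwd e _ _) = (e , false) , refl
  onto′ v (bwd e _ _) = (e , true) , refl

  M : Map g (S G) (A G) F
  M = record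
    { tail        = tailOf (ends G)
    ; next        = σ G
    ; face        = face
    ; outer       = face d₀
    ; tail-onto   = λ v → onto′ v (connected G _ v)
    ; face-onto   = λ f → proj₁ (onto f) , proj₂ (onto f) refl
    ; next-orbits = fromLabel⇔Reaches (σ-cycles G)
    ; walk-orbits = walks
    ; complete    = λ e → let k , p = compl e in
        proj₂ (iter k (τ G) d₀) ,
        trans (cong (λ e → face (e , proj₂ (iter k (τ G) d₀))) (sym p)) (iter-invariant walks k d₀)
    ; euler       = eul
    }

-- Both reduced graphs filter the same list of vertex pairs. Only distinct vertices are compared, so
-- loops may disappear from `N`.
arMap-mono : ∀ {g g′ S A A′ F F′} (M : Map g S A F) (N : Map g′ S A′ F′) →
  (∀ {u v} → u ≢ v → Adj (toPolGraph M) u v → Adj (toPolGraph N) u v) →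
  arMap M ≤ arMap N
arMap-mono {S = S} M N h = length-filter-mono _ _ (λ _ (u<v , a) → u<v , h (FinP.<⇒≢ u<v) a)
  (cartesianProduct (allFin S) (allFin S))

-- Ordinary graphs

record IsSimple {g S A F} (M : Map g S A F) : Set where
  open Map M
  field
    no-loop     : ∀ d → tail d ≢ tail (rev d)
    no-parallel : ∀ d d′ → tail d ≡ tail d′ → tail (rev d) ≡ tail (rev d′) → d ≡ d′

-- Each edge, oriented from its smaller to its larger end, has a position in the list of reduced
-- edges, and `no-parallel` recovers the edge from that position.
simple⇒A≤arMap : ∀ {g S A F} (M : Map g S A F) → IsSimple M → A ≤ arMap M
simple⇒A≤arMap {S = S} {A} M simple = FinP.injective⇒≤ {f = λ e → Any.index (listed e)} λ {e} {e′} p →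
  cong proj₁ (no-parallel (dart e) (dart e′)
    (cong proj₁ (same p)) (cong proj₂ (same p)))
  where
  open Map M
  open IsSimple simple
  open ReducedEdges (toPolGraph M)

  orient : ∀ e → ∃ λ b → tail (e , b) Fin.< tail (rev (e , b))
  orient e with FinP.<-cmp (tail (e , true)) (tail (e , false))
  ... | tri< lt _ _ = true , lt
  ... | tri≈ _ eq _ = contradiction eq (no-loop (e , true))
  ... | tri> _ _ gt = false , gt

  dart : Fin A → Dart A
  dart e = e , proj₁ (orient e)

  ends′ : Fin A → Fin S × Fin S
  ends′ e = tail (dart e) , tail (rev (dart e))

  listed : ∀ e → ends′ e ∈ reducedEdges
  listed e = ∈-reducedEdges (proj₂ (orient e)) (adj-darts M (dart e))

  same : ∀ {e e′} → Any.index (listed e) ≡ Any.index (listed e′) → ends′ e ≡ ends′ e′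
  same {e} {e′} p = trans (AnyP.lookup-index (listed e))
    (trans (cong (lookup reducedEdges) p) (sym (AnyP.lookup-index (listed e′))))

-- Faces

module _ {g S A F : ℕ} (M : Map g S A (suc F)) where
  open Map M

  private
    -- The outer walk uses at least one of two opposite darts, so at most one dart of an edge lies
    -- on an inner face.
    not-outer⇒ : ∀ {d d′} → face d ≢ outer → face d′ ≢ outer → proj₁ d ≡ proj₁ d′ → d ≡ d′
    not-outer⇒ {e , b} {e , b′} p q refl with b BoolP.≟ b′
    ... | yes refl = refl
    ... | no b≢b′ with c , r ← complete e with c BoolP.≟ b | c BoolP.≟ b′
    ... | yes refl | _        = contradiction r p
    ... | no _     | yes refl = contradiction r q
    ... | no c≢b   | no c≢b′  = contradiction
      (trans (BoolP.¬-not c≢b) (trans (cong not (BoolP.¬-not b≢b′)) (BoolP.not-involutive b′))) c≢b′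

  -- Every edge is on the outer walk, hence on the boundary of at most one other face.
  3F≤A : (∀ d → face d ≢ outer → walk d ≢ d × walk (walk d) ≢ d) → F * 3 ≤ A
  3F≤A long = FinP.injective⇒≤ {f = edgeAt ∘ Fin.remQuot 3} λ {x} {y} p →
    trans (sym (FinP.combine-remQuot {F} 3 x))
      (trans (cong (λ (i , j) → Fin.combine i j) (edgeAt-injective (Fin.remQuot 3 x) (Fin.remQuot 3 y) p))
        (FinP.combine-remQuot {F} 3 y))
    where
    base : Fin F → Dart A
    base i = proj₁ (face-onto (Fin.punchIn outer i))

    step : Fin 3 → Dart A → Dart A
    step j = iter (Fin.toℕ j) walk

    dartAt : Fin F × Fin 3 → Dart A
    dartAt (i , j) = step j (base i)

    edgeAt : Fin F × Fin 3 → Fin A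
    edgeAt x = proj₁ (dartAt x)

    dartAt-face : ∀ x → face (dartAt x) ≡ Fin.punchIn outer (proj₁ x)
    dartAt-face (i , j) =
      trans (iter-invariant walk-orbits (Fin.toℕ j) _) (proj₂ (face-onto (Fin.punchIn outer i)))

    dartAt-inner : ∀ x → face (dartAt x) ≢ outer
    dartAt-inner x p = FinP.punchInᵢ≢i outer (proj₁ x) (trans (sym (dartAt-face x)) p)

    -- `long` excludes a return after one or two steps. A coincidence of `walk d` with
    -- `walk (walk d)` reduces to a return after one step, since `walk` is injective.
    step-injective : ∀ d → face d ≢ outer → ∀ j k → step j d ≡ step k d → j ≡ k
    step-injective d p zero             zero             q = refl
    step-injective d p zero             (suc zero)       q = contradiction (sym q) (proj₁ (long d p))
    step-injective d p zero             (suc (suc zero)) q = contradiction (sym q) (proj₂ (long d p))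
    step-injective d p (suc zero)       zero             q = contradiction q (proj₁ (long d p))
    step-injective d p (suc zero)       (suc zero)       q = refl
    step-injective d p (suc zero)       (suc (suc zero)) q =
      contradiction (injective walk-orbits (sym q)) (proj₁ (long d p))
    step-injective d p (suc (suc zero)) zero             q = contradiction q (proj₂ (long d p))
    step-injective d p (suc (suc zero)) (suc zero)       q =
      contradiction (injective walk-orbits q) (proj₁ (long d p))
    step-injective d p (suc (suc zero)) (suc (suc zero)) q = refl

    edgeAt-injective : ∀ x y → edgeAt x ≡ edgeAt y → x ≡ y
    edgeAt-injective x@(i , j) y@(i′ , j′) p
      with q ← not-outer⇒ (dartAt-inner x) (dartAt-inner y) p
      with refl ← FinP.punchIn-injective outer i i′
             (trans (sym (dartAt-face x)) (trans (cong face q) (dartAt-face y))) =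
      cong (i ,_) (step-injective (base i) (dartAt-inner (i , zero)) j j′ q)

_≟D_ : ∀ {A} (d d′ : Dart A) → Dec (d ≡ d′)
_≟D_ = ≡-dec FinP._≟_ BoolP._≟_

anyDart? : ∀ {A} {P : Dart A → Set} → Decidable P → Dec (∃ P)
anyDart? P? = map′
  (λ { (e , inj₁ p) → (e , true) , p ; (e , inj₂ p) → (e , false) , p })
  (λ { ((e , true) , p) → e , inj₁ p ; ((e , false) , p) → e , inj₂ p })
  (FinP.any? λ e → P? (e , true) ⊎-dec P? (e , false))

allDarts? : ∀ {A} {P : Dart A → Set} → Decidable P → Dec (∀ d → P d)
allDarts? P? = map′
  (λ { h (e , true) → proj₁ (h e) ; h (e , false) → proj₂ (h e) })
  (λ h e → h (e , true) , h (e , false))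
  (FinP.all? λ e → P? (e , true) ×-dec P? (e , false))

same-edge : ∀ {A} {e : Fin A} b (x : Dart A) → e ≡ proj₁ x → x ≡ (e , b) ⊎ x ≡ (e , not b)
same-edge b (e , c) refl with c BoolP.≟ b
... | yes refl = inj₁ refl
... | no c≢b   = inj₂ (cong (e ,_) (BoolP.¬-not c≢b))

inner⇒rev-outer : ∀ {g S A F} (M : Map g S A F) → let open Map M in
  ∀ {e b} → face (e , b) ≢ outer → face (e , not b) ≡ outer
inner⇒rev-outer M {e} {b} inner = let c , p = complete e in
  Sum.[ (λ q → contradiction (trans (cong face (sym q)) p) inner)
      , (λ q → trans (cong face (sym q)) p)
      ]′ (same-edge b (e , c) refl)
  where open Map M

-- Deletion of a loop or of a parallel edge separating the outer walk from another face

module DeleteEdge {g S A F : ℕ} (M : Map g S (suc (suc A)) (suc F)) where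
  open Map M

  module _ (e : Fin (suc (suc A))) (b : Bool) (inner : face (e , b) ≢ outer)
    (tail-covered : ∀ c → ∃ λ x → e ≢ proj₁ x × tail x ≡ tail (e , c))
    (superfluous : tail (e , b) ≡ tail (e , not b) ⊎
       ∃ λ x → e ≢ proj₁ x × tail x ≡ tail (e , b) × tail (rev x) ≡ tail (e , not b))
    where

    private
      d d̄ : Dart (suc (suc A))
      d = e , b
      d̄ = e , not b

      Deleted : Dart (suc (suc A)) → Set
      Deleted x = e ≡ proj₁ x

      embed : Dart (suc A) → Dart (suc (suc A))
      embed (e′ , c) = Fin.punchIn e e′ , c

      embed-injective : ∀ {x y} → embed x ≡ embed y → x ≡ y
      embed-injective {e′ , c} {e″ , c′} p =
        let q , r = ,-injective p in cong₂ _,_ (FinP.punchIn-injective e e′ e″ q) r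

      embed-kept : ∀ x → ¬ Deleted (embed x)
      embed-kept x p = FinP.punchInᵢ≢i e (proj₁ x) (sym p)

      restore : ∀ x → e ≢ proj₁ x → ∃ λ a → x ≡ embed a
      restore (e′ , c) p = (Fin.punchOut p , c) , cong (_, c) (sym (FinP.punchIn-punchOut p))

      deleted-or-kept : ∀ x → Deleted x ⊎ ∃ λ a → x ≡ embed a
      deleted-or-kept x with e FinP.≟ proj₁ x
      ... | yes p = inj₁ p
      ... | no ¬p = inj₂ (restore x ¬p)

      deleted⇒ : ∀ x → Deleted x → x ≡ d ⊎ x ≡ d̄
      deleted⇒ = same-edge b

      d̄-outer : face d̄ ≡ outer
      d̄-outer = inner⇒rev-outer M inner

      firstReturn : ∀ x → ∃ λ a → FirstHit next Deleted embed (next (embed x)) a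
      firstReturn x = let k , p = transitive next-orbits (invariant next-orbits (embed x)) in
        firstHit-exists deleted-or-kept embed-kept k (next (embed x)) x p

      next′ : Dart (suc A) → Dart (suc A)
      next′ x = proj₁ (firstReturn x)

      -- The left walk with the images of `d` and `d̄` exchanged. On a deleted dart it acts as
      -- `next`, so following it through deleted darts repeats the search by which `next′` skips
      -- them: the left walk after deletion is its first-return map.
      rerouted : Dart (suc (suc A)) → Dart (suc (suc A))
      rerouted x with e FinP.≟ proj₁ x
      ... | yes _ = walk (rev x)
      ... | no _  = walk x

      rerouted-deleted : ∀ x → Deleted x → rerouted x ≡ walk (rev x)
      rerouted-deleted x p with e FinP.≟ proj₁ x
      ... | yes _ = refl
      ... | no ¬p = contradiction p ¬p

      rerouted-kept : ∀ x → ¬ Deleted x → rerouted x ≡ walk x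
      rerouted-kept x ¬p with e FinP.≟ proj₁ x
      ... | yes p = contradiction p ¬p
      ... | no _  = refl

      identify : Fin (suc F) → Fin (suc F)
      identify u with u FinP.≟ face d
      ... | yes _ = outer
      ... | no _  = u

      identify-inner : ∀ u → u ≡ face d → identify u ≡ outer
      identify-inner u p with u FinP.≟ face d
      ... | yes _ = refl
      ... | no ¬p = contradiction p ¬p

      identify-else : ∀ u → u ≢ face d → identify u ≡ u
      identify-else u ¬p with u FinP.≟ face d
      ... | yes p = contradiction p ¬p
      ... | no _  = refl

      identify≢ : ∀ u → face d ≢ identify u
      identify≢ u with u FinP.≟ face d
      ... | yes _ = inner
      ... | no ¬p = ¬p ∘ sym

      -- The label of the absorbed face is renamed to `outer` by `identify`; `punchOut` then closes
      -- the gap left in the numbering.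
      relabel : Fin (suc F) → Fin F
      relabel u = Fin.punchOut (identify≢ u)

      relabel-≡ : ∀ u v → identify u ≡ identify v → relabel u ≡ relabel v
      relabel-≡ u v = FinP.punchOut-cong (face d)

      relabel-punchIn : ∀ u f → identify u ≡ Fin.punchIn (face d) f → relabel u ≡ f
      relabel-punchIn u f p = FinP.punchIn-injective (face d) _ _
        (trans (FinP.punchIn-punchOut (identify≢ u)) p)

      relabel-injective : ∀ u v → relabel u ≡ relabel v →
        u ≡ v ⊎ ((u ≡ face d ⊎ u ≡ face d̄) × (v ≡ face d ⊎ v ≡ face d̄))
      relabel-injective u v p
        with q ← FinP.punchOut-injective (identify≢ u) (identify≢ v) p
        with u FinP.≟ face d | v FinP.≟ face d
      ... | yes r | yes s = inj₁ (trans r (sym s))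
      ... | yes r | no _  = inj₂ (inj₁ r , inj₂ (trans (sym q) (sym d̄-outer)))
      ... | no _  | yes s = inj₂ (inj₂ (trans q (sym d̄-outer)) , inj₁ s)
      ... | no _  | no _  = inj₁ q

      rerouted-orbits : IsOrbitLabelling rerouted (relabel ∘ face)
      rerouted-orbits = MergeOrbits.merged walk-orbits _≟D_ FinP._≟_ {d} {d̄}
        (λ p → inner (trans p d̄-outer))
        (rerouted-deleted d refl)
        (trans (rerouted-deleted d̄ refl) (cong walk (rev-rev d)))
        (λ z z≢d z≢d̄ → rerouted-kept z λ p → Sum.[ z≢d , z≢d̄ ] (deleted⇒ z p))
        relabel
        (relabel-≡ (face d) (face d̄) (trans (identify-inner (face d) refl) (trans (sym d̄-outer)
          (sym (identify-else (face d̄) λ p → inner (trans (sym p) d̄-outer))))))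
        relabel-injective

      walk′-firstReturn : ∀ x → FirstHit rerouted Deleted embed (rerouted (embed x)) (next′ (rev x))
      walk′-firstReturn x =
        subst (λ y → FirstHit rerouted Deleted embed y (next′ (rev x)))
          (sym (rerouted-kept (embed x) (embed-kept x)))
          (firstHit-map
            (λ y p → trans (cong next (sym (rev-rev y))) (sym (rerouted-deleted y p)))
            (proj₂ (firstReturn (rev x))))

      tail-onto′ : ∀ v → ∃ λ a → tail (embed a) ≡ v
      tail-onto′ v with x , refl ← tail-onto v with deleted-or-kept x
      ... | inj₂ (a , p) = a , cong tail (sym p)
      ... | inj₁ refl with y , y-kept , q ← tail-covered (proj₂ x) =
        let a , r = restore y y-kept in a , trans (cong tail (sym r)) q

      face-onto′ : ∀ f → ∃ λ a → relabel (face (embed a)) ≡ f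
      face-onto′ f with Fin.punchIn (face d) f FinP.≟ outer
      -- The outer face must keep a dart. The map has at least two edges, and the outer walk also
      -- uses an edge other than `e`.
      ... | yes p with c , q ← complete (Fin.punchIn e zero) =
        (zero , c) , relabel-punchIn (face (embed (zero , c))) f
          (trans (identify-else (face (embed (zero , c))) (λ r → inner (trans (sym r) q))) (trans q (sym p)))
      ... | no ¬p with x , q ← face-onto (Fin.punchIn (face d) f) with deleted-or-kept x
      ... | inj₂ (a , r) = a , relabel-punchIn (face (embed a)) f
              (trans (cong (identify ∘ face) (sym r)) (trans (cong identify q)
                (identify-else (Fin.punchIn (face d) f) (FinP.punchInᵢ≢i (face d) f))))
      ... | inj₁ r with deleted⇒ x r
      ... | inj₁ refl = contradiction (sym q) (FinP.punchInᵢ≢i (face d) f)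
      ... | inj₂ refl = contradiction (trans (sym q) d̄-outer) ¬p

    deleteEdge : Map g S (suc A) F
    deleteEdge = record
      { tail        = tail ∘ embed
      ; next        = next′
      ; face        = relabel ∘ face ∘ embed
      ; outer       = relabel outer
      ; tail-onto   = tail-onto′
      ; face-onto   = face-onto′
      ; next-orbits = restrict next-orbits embed-injective embed-kept (proj₂ ∘ firstReturn)
      ; walk-orbits = restrict rerouted-orbits embed-injective embed-kept walk′-firstReturn
      ; complete    = λ e′ → let c , p = complete (Fin.punchIn e e′) in c , cong relabel p
      ; euler       = ℕP.suc-injective (trans (cong (_+ 2 * g) (sym (ℕP.+-suc S F))) euler)
      }

    private
      adj-deleted : ∀ x → x ≡ d ⊎ x ≡ d̄ → tail x ≢ tail (rev x) →
        (tail d ≡ tail d̄ ⊎ ∃ λ y → e ≢ proj₁ y × tail y ≡ tail d × tail (rev y) ≡ tail d̄) →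
        Adj (toPolGraph deleteEdge) (tail x) (tail (rev x))
      adj-deleted x (inj₁ refl) proper (inj₁ loop) = contradiction loop proper
      adj-deleted x (inj₂ refl) proper (inj₁ loop) =
        contradiction (trans (sym loop) (cong tail (sym (rev-rev d)))) proper
      adj-deleted x x∈e proper (inj₂ (y , y-kept , q , r)) with restore y y-kept | x∈e
      ... | a , refl | inj₁ refl =
        subst₂ (Adj (toPolGraph deleteEdge)) q r (adj-darts deleteEdge a)
      ... | a , refl | inj₂ refl =
        subst₂ (Adj (toPolGraph deleteEdge)) r
          (trans (cong (tail ∘ embed) (rev-rev a)) (trans q (cong tail (sym (rev-rev d)))))
          (adj-darts deleteEdge (rev a))

      adj-kept : ∀ x → tail x ≢ tail (rev x) → Adj (toPolGraph deleteEdge) (tail x) (tail (rev x))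
      adj-kept x proper with deleted-or-kept x
      ... | inj₂ (a , refl) = adj-darts deleteEdge a
      ... | inj₁ p          = adj-deleted x (deleted⇒ x p) proper superfluous

    deleteEdge-arMap : arMap M ≤ arMap deleteEdge
    deleteEdge-arMap = arMap-mono M deleteEdge λ u≢v a → keep u≢v (adj⇒dart M a)
      where
      keep : ∀ {u v} → u ≢ v → (∃ λ x → tail x ≡ u × tail (rev x) ≡ v) →
             Adj (toPolGraph deleteEdge) u v
      keep u≢v (x , refl , refl) = adj-kept x u≢v

-- Removal of inner faces with one or two sides

NoShortFace : ∀ {g S A F} → Map g S A F → Set
NoShortFace M = ∀ d → face d ≢ outer → walk d ≢ d × walk (walk d) ≢ d
  where open Map M

ShortDart : ∀ {g S A F} (M : Map g S A F) → Dart A → Set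
ShortDart M d = face d ≢ outer × (walk d ≡ d ⊎ walk (walk d) ≡ d)
  where open Map M

shortDart? : ∀ {g S A F} (M : Map g S A F) → Dec (∃ (ShortDart M))
shortDart? M = anyDart? λ d →
  ¬? (face d FinP.≟ outer) ×-dec (walk d ≟D d ⊎-dec walk (walk d) ≟D d)
  where open Map M

module _ {g S A F : ℕ} (M : Map g S (suc (suc A)) (suc F)) where
  open Map M
  open DeleteEdge M

  removeShortFace : ∃ (ShortDart M) → Σ (Map g S (suc A) F) λ N → arMap M ≤ arMap N
  removeShortFace (d@(e , b) , inner , short) =
    deleteEdge e b inner covered superfluous , deleteEdge-arMap e b inner covered superfluous
    where
    d̄-face : face (e , not b) ≡ outer
    d̄-face = inner⇒rev-outer M inner

    own-edge : ∀ x → e ≡ proj₁ x → x ≡ d ⊎ x ≡ (e , not b)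
    own-edge = same-edge b

    -- If d̄ were fixed by the walk, the outer face would contain no edge but e.
    d̄-moves : walk (e , not b) ≢ (e , not b)
    d̄-moves p with c , q ← complete (Fin.punchIn e zero)
      with k , r ← transitive walk-orbits (trans d̄-face (sym q)) =
      FinP.punchInᵢ≢i e zero (sym (cong proj₁ (trans (sym (stay k)) r)))
      where
      stay : ∀ k → iter k walk (e , not b) ≡ (e , not b)
      stay zero    = refl
      stay (suc k) = trans (cong walk (stay k)) p

    -- The dart that follows the reverse of `d` on the outer walk starts where `d` does. It is not
    -- `d`, which lies on an inner face, nor the reverse of `d`, by `d̄-moves`. A monogon is a loop,
    -- so this dart serves both ends.
    loop⇒covered : walk d ≡ d → ∀ c → ∃ λ x → e ≢ proj₁ x × tail x ≡ tail (e , c)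
    loop⇒covered p c = walk (e , not b) , kept , tails (own-edge (e , c) refl)
      where
      d-loop : tail d ≡ tail (e , not b)
      d-loop = trans (cong tail (sym p)) (walk-tail d)

      kept : e ≢ proj₁ (walk (e , not b))
      kept q with own-edge _ q
      ... | inj₁ r = inner (trans (cong face (sym r)) (trans (invariant walk-orbits _) d̄-face))
      ... | inj₂ r = d̄-moves r

      tails : ∀ {x} → x ≡ d ⊎ x ≡ (e , not b) → tail (walk (e , not b)) ≡ tail x
      tails (inj₁ refl) = trans (walk-tail _) (cong tail (rev-rev d))
      tails (inj₂ refl) = trans (tails (inj₁ refl)) d-loop

    -- `walk d` is the second side of the digon, and reversed it runs parallel to `d`. It lies on
    -- the inner face while the reverse of `d` lies on the outer one, so it belongs to another edge.
    digon⇒parallel : walk d ≢ d → walk (walk d) ≡ d →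
      ∃ λ x → e ≢ proj₁ x × tail x ≡ tail d × tail (rev x) ≡ tail (e , not b)
    digon⇒parallel ≢d p = rev (walk d) , kept , trans (sym (walk-tail (walk d))) (cong tail p) ,
      trans (cong tail (rev-rev (walk d))) (walk-tail d)
      where
      kept : e ≢ proj₁ (walk d)
      kept q with own-edge _ q
      ... | inj₁ r = ≢d r
      ... | inj₂ r = inner (trans (sym (invariant walk-orbits d)) (trans (cong face r) d̄-face))

    parallel⇒covered : (∃ λ x → e ≢ proj₁ x × tail x ≡ tail d × tail (rev x) ≡ tail (e , not b)) →
      ∀ c → ∃ λ x → e ≢ proj₁ x × tail x ≡ tail (e , c)
    parallel⇒covered (x , kept , p , q) c with own-edge (e , c) refl
    ... | inj₁ refl = x , kept , p
    ... | inj₂ refl = rev x , kept , q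

    monogon-or-digon : Dec (walk d ≡ d) → walk d ≡ d ⊎ walk (walk d) ≡ d →
      walk d ≡ d ⊎ (walk d ≢ d × walk (walk d) ≡ d)
    monogon-or-digon (yes p) _        = inj₁ p
    monogon-or-digon (no ≢d) (inj₁ p) = contradiction p ≢d
    monogon-or-digon (no ≢d) (inj₂ p) = inj₂ (≢d , p)

    kind : walk d ≡ d ⊎ (walk d ≢ d × walk (walk d) ≡ d)
    kind = monogon-or-digon (walk d ≟D d) short

    covered : ∀ c → ∃ λ x → e ≢ proj₁ x × tail x ≡ tail (e , c)
    covered = Sum.[ loop⇒covered , (λ (≢d , p) → parallel⇒covered (digon⇒parallel ≢d p)) ] kind

    superfluous : tail d ≡ tail (e , not b) ⊎
      ∃ λ x → e ≢ proj₁ x × tail x ≡ tail d × tail (rev x) ≡ tail (e , not b)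
    superfluous = Sum.map (λ p → trans (cong tail (sym p)) (walk-tail d))
                          (λ (≢d , p) → digon⇒parallel ≢d p) kind

-- A map contains a dart, and deletion relies on a second edge. The process can therefore also stop
-- at a single edge with a short face left, as for a loop on the sphere.
record Reduced {g S A F} (M : Map g S A F) : Set where
  field
    {A′ F′} : ℕ
    map     : Map g S A′ (suc F′)
    more    : arMap M ≤ arMap map
    short   : A′ ≤ 1 ⊎ NoShortFace map

reduce : ∀ {g S A F} (M : Map g S A F) → Reduced M
reduce {F = zero} M with () ← Map.outer M
reduce {A = zero} {suc F} M = record { map = M ; more = ℕP.≤-refl ; short = inj₁ ℕ.z≤n }
reduce {A = suc zero} {suc F} M = record { map = M ; more = ℕP.≤-refl ; short = inj₁ ℕP.≤-refl }
reduce {A = suc (suc A)} {suc F} M with shortDart? M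
... | no ¬short = record { map = M ; more = ℕP.≤-refl ; short = inj₂ λ d inner →
        (λ p → ¬short (d , inner , inj₁ p)) , (λ p → ¬short (d , inner , inj₂ p)) }
... | yes short with N , le ← removeShortFace M short =
  record { map = R.map ; more = ℕP.≤-trans le R.more ; short = R.short }
  where module R = Reduced (reduce N)

-- Decidability of orbit labellings

dartCode : ∀ {A} → Dart A → Fin (A * 2)
dartCode (e , b) = Fin.combine e (Inverse.from FinP.2↔Bool b)

codeDart : ∀ {A} → Fin (A * 2) → Dart A
codeDart {A} c = proj₁ (Fin.remQuot {A} 2 c) , Inverse.to FinP.2↔Bool (proj₂ (Fin.remQuot {A} 2 c))

codeDart-dartCode : ∀ {A} (d : Dart A) → codeDart (dartCode d) ≡ d
codeDart-dartCode {A} (e , b) = cong₂ _,_ (cong proj₁ q)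
  (trans (cong (Inverse.to FinP.2↔Bool ∘ proj₂) q) (Inverse.strictlyInverseˡ FinP.2↔Bool b))
  where q = FinP.remQuot-combine {A} {2} e (Inverse.from FinP.2↔Bool b)

dartCode-injective : ∀ {A} {d d′ : Dart A} → dartCode d ≡ dartCode d′ → d ≡ d′
dartCode-injective {d = d} {d′} p =
  trans (sym (codeDart-dartCode d)) (trans (cong codeDart p) (codeDart-dartCode d′))

module _ {A : ℕ} (f : Dart A → Dart A) where

  -- The 2A + 1 iterates with exponents 0 to 2A cannot be distinct, and cutting the loop between two
  -- equal ones shortens a longer path. Reachability thus becomes a finite search, for the concrete
  -- tables as well as for the enumeration.
  reaches-bounded : ∀ {x y} k → iter k f x ≡ y → ∃ λ (j : Fin (suc (A * 2))) → iter (toℕ j) f x ≡ y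
  reaches-bounded {x} {y} = <-rec _ shorten
    where
    shorten : ∀ k → (∀ {l} → l ℕ.< k → iter l f x ≡ y → ∃ λ (j : Fin (suc (A * 2))) → iter (toℕ j) f x ≡ y) →
              iter k f x ≡ y → ∃ λ (j : Fin (suc (A * 2))) → iter (toℕ j) f x ≡ y
    shorten k rec p with k ℕP.<? suc (A * 2)
    ... | yes k< = Fin.fromℕ< k< , trans (cong (λ l → iter l f x) (FinP.toℕ-fromℕ< k<)) p
    ... | no k≮ with i , j , i<j , q ← FinP.pigeonhole (ℕP.n<1+n (A * 2)) (λ i → dartCode (iter (toℕ i) f x)) =
      rec smaller (begin
        iter (k ∸ toℕ j + toℕ i) f x          ≡⟨ iter-+ f (k ∸ toℕ j) (toℕ i) x ⟩
        iter (k ∸ toℕ j) f (iter (toℕ i) f x) ≡⟨ cong (iter (k ∸ toℕ j) f) (dartCode-injective q) ⟩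
        iter (k ∸ toℕ j) f (iter (toℕ j) f x) ≡⟨ iter-+ f (k ∸ toℕ j) (toℕ j) x ⟨
        iter (k ∸ toℕ j + toℕ j) f x          ≡⟨ cong (λ l → iter l f x) j+ ⟩
        iter k f x                            ≡⟨ p ⟩
        y ∎)
      where
      open ≡-Reasoning
      j+ : k ∸ toℕ j + toℕ j ≡ k
      j+ = ℕP.m∸n+n≡m (ℕP.≤-trans (ℕP.<⇒≤ (FinP.toℕ<n j)) (ℕP.≮⇒≥ k≮))
      smaller : k ∸ toℕ j + toℕ i ℕ.< k
      smaller = subst (k ∸ toℕ j + toℕ i ℕ.<_) j+ (ℕP.+-monoʳ-< (k ∸ toℕ j) i<j)

  reaches? : ∀ x y → Dec (Reaches f x y)
  reaches? x y = map′ (λ (j , p) → toℕ j , p) (λ (k , p) → reaches-bounded k p)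
    (FinP.any? {n = suc (A * 2)} λ j → iter (toℕ j) f x ≟D y)

  orbitLabelling? : ∀ {n} (ℓ : Dart A → Fin n) → Dec (IsOrbitLabelling f ℓ)
  orbitLabelling? ℓ = map′
    (λ (i , t) → record { invariant = i ; transitive = λ {x} {y} → t x y })
    (λ O → invariant O , λ x y → transitive O)
    (allDarts? (λ x → ℓ (f x) FinP.≟ ℓ x)
     ×-dec allDarts? λ x → allDarts? λ y → (ℓ x FinP.≟ ℓ y) →-dec reaches? x y)

-- One-point unions

module _ {n m : ℕ} (r : Fin n) where

  glue : Fin n ⊎ Fin (suc m) → Fin (n + m)
  glue (inj₁ u)       = u Fin.↑ˡ m
  glue (inj₂ zero)    = r Fin.↑ˡ m
  glue (inj₂ (suc v)) = n Fin.↑ʳ v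

  ↑ˡ≢↑ʳ : ∀ (u : Fin n) (v : Fin m) → u Fin.↑ˡ m ≢ n Fin.↑ʳ v
  ↑ˡ≢↑ʳ u v p with () ←
    trans (sym (FinP.splitAt-↑ˡ n u m)) (trans (cong (Fin.splitAt n) p) (FinP.splitAt-↑ʳ n m v))

  IsRoot : Fin n ⊎ Fin (suc m) → Set
  IsRoot u = u ≡ inj₁ r ⊎ u ≡ inj₂ zero

  glue-injective : ∀ u v → glue u ≡ glue v → u ≡ v ⊎ (IsRoot u × IsRoot v)
  glue-injective (inj₁ u)       (inj₁ v)       p = inj₁ (cong inj₁ (FinP.↑ˡ-injective m u v p))
  glue-injective (inj₁ u)       (inj₂ zero)    p =
    inj₂ (inj₁ (cong inj₁ (FinP.↑ˡ-injective m u r p)) , inj₂ refl)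
  glue-injective (inj₁ u)       (inj₂ (suc v)) p = contradiction p (↑ˡ≢↑ʳ u v)
  glue-injective (inj₂ zero)    (inj₁ v)       p =
    inj₂ (inj₂ refl , inj₁ (cong inj₁ (sym (FinP.↑ˡ-injective m r v p))))
  glue-injective (inj₂ zero)    (inj₂ zero)    p = inj₁ refl
  glue-injective (inj₂ zero)    (inj₂ (suc v)) p = contradiction p (↑ˡ≢↑ʳ r v)
  glue-injective (inj₂ (suc u)) (inj₁ v)       p = contradiction (sym p) (↑ˡ≢↑ʳ v u)
  glue-injective (inj₂ (suc u)) (inj₂ zero)    p = contradiction (sym p) (↑ˡ≢↑ʳ r u)
  glue-injective (inj₂ (suc u)) (inj₂ (suc v)) p = inj₁ (cong (inj₂ ∘ suc) (FinP.↑ʳ-injective n u v p))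

  glue-onto : ∀ w → ∃ λ u → glue u ≡ w
  glue-onto w with Fin.splitAt n w | FinP.join-splitAt n m w
  ... | inj₁ u | p = inj₁ u , p
  ... | inj₂ v | p = inj₂ (suc v) , p

module _ {A₁ A₂ : ℕ} where

  splitDart : Dart (A₁ + A₂) → Dart A₁ ⊎ Dart A₂
  splitDart (e , b) = Sum.map (_, b) (_, b) (Fin.splitAt A₁ e)

  joinDart : Dart A₁ ⊎ Dart A₂ → Dart (A₁ + A₂)
  joinDart (inj₁ (e , b)) = e Fin.↑ˡ A₂ , b
  joinDart (inj₂ (e , b)) = A₁ Fin.↑ʳ e , b

  splitDart-joinDart : ∀ x → splitDart (joinDart x) ≡ x
  splitDart-joinDart (inj₁ (e , b)) = cong (Sum.map (_, b) (_, b)) (FinP.splitAt-↑ˡ A₁ e A₂)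
  splitDart-joinDart (inj₂ (e , b)) = cong (Sum.map (_, b) (_, b)) (FinP.splitAt-↑ʳ A₁ A₂ e)

  joinDart-splitDart : ∀ d → joinDart (splitDart d) ≡ d
  joinDart-splitDart (e , b) with Fin.splitAt A₁ e | FinP.join-splitAt A₁ A₂ e
  ... | inj₁ _ | p = cong (_, b) p
  ... | inj₂ _ | p = cong (_, b) p

  splitDart-injective : ∀ {d d′} → splitDart d ≡ splitDart d′ → d ≡ d′
  splitDart-injective {d} {d′} p =
    trans (sym (joinDart-splitDart d)) (trans (cong joinDart p) (joinDart-splitDart d′))

  splitDart-rev : ∀ d → splitDart (rev d) ≡ Sum.map rev rev (splitDart d)
  splitDart-rev (e , b) with Fin.splitAt A₁ e
  ... | inj₁ _ = refl
  ... | inj₂ _ = refl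

-- This is the exchange of two images in a disjoint union, with `glue r` giving the joined orbits
-- one label. It serves for `next` at the reversed roots and for the left walk at the roots
-- themselves, as composition with `rev` turns the first exchange into the second.
glue-labelling : ∀ {X₁ X₂ : Set} {n m} {f₁ : X₁ → X₁} {f₂ : X₂ → X₂}
  {ℓ₁ : X₁ → Fin n} {ℓ₂ : X₂ → Fin (suc m)} {f′ : X₁ ⊎ X₂ → X₁ ⊎ X₂} →
  (∀ (a b : X₁) → Dec (a ≡ b)) → (∀ (a b : X₂) → Dec (a ≡ b)) →
  IsOrbitLabelling f₁ ℓ₁ → IsOrbitLabelling f₂ ℓ₂ →
  ∀ {r x y} → ℓ₁ x ≡ r → ℓ₂ y ≡ zero →
  f′ (inj₁ x) ≡ inj₂ (f₂ y) → f′ (inj₂ y) ≡ inj₁ (f₁ x) →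
  (∀ z → z ≢ x → f′ (inj₁ z) ≡ inj₁ (f₁ z)) → (∀ z → z ≢ y → f′ (inj₂ z) ≡ inj₂ (f₂ z)) →
  IsOrbitLabelling f′ (glue r ∘ Sum.map ℓ₁ ℓ₂)
glue-labelling {ℓ₁ = ℓ₁} {ℓ₂} _≟₁_ _≟₂_ O₁ O₂ {r} {x} {y} refl q f′x f′y else₁ else₂ =
  MergeOrbits.merged (sum-labelling O₁ O₂) (SumP.≡-dec _≟₁_ _≟₂_) (SumP.≡-dec FinP._≟_ FinP._≟_)
    {inj₁ x} {inj₂ y} (λ ()) f′x f′y
    (λ { (inj₁ z) ≢x _ → else₁ z (≢x ∘ cong inj₁) ; (inj₂ z) _ ≢y → else₂ z (≢y ∘ cong inj₂) })
    (glue r) (cong (glue r ∘ inj₂) (sym q))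
    λ u v p → Sum.map₂ (λ (a , b) → root a , root b) (glue-injective r u v p)
  where
  root : ∀ {u} → IsRoot r u → u ≡ inj₁ (ℓ₁ x) ⊎ u ≡ inj₂ (ℓ₂ y)
  root = Sum.map₂ (λ p → trans p (cong inj₂ (sym q)))

-- `glue` absorbs the label zero of its second summand, so the vertex and the face of `P` that
-- disappear must both be numbered zero. The root marks a corner where they meet.
record Rooted {g s A f} (P : Map g (suc s) A (suc f)) : Set where
  open Map P
  field
    root         : Dart A
    root-face    : face root ≡ zero
    root-head    : tail (rev root) ≡ zero
    outer-zero   : outer ≡ zero

module Wedge {g₁ g₂ S₁ s A₁ A₂ F₁ f : ℕ}
  (M : Map g₁ S₁ A₁ F₁) (P : Map g₂ (suc s) A₂ (suc f)) (rooted : Rooted P) where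

  private
    module M = Map M
    module P = Map P
  open Rooted rooted

  private
    X : Set
    X = Dart A₁ ⊎ Dart A₂

    d₁ : Dart A₁
    d₁ = M.start

    d₂ : Dart A₂
    d₂ = root

    hub : Fin S₁
    hub = M.tail (rev d₁)

    nextX : X → X
    nextX (inj₁ z) with z ≟D rev d₁
    ... | yes _ = inj₂ (P.next (rev d₂))
    ... | no _  = inj₁ (M.next z)
    nextX (inj₂ z) with z ≟D rev d₂
    ... | yes _ = inj₁ (M.next (rev d₁))
    ... | no _  = inj₂ (P.next z)

    next-x : nextX (inj₁ (rev d₁)) ≡ inj₂ (P.next (rev d₂))
    next-x with rev d₁ ≟D rev d₁
    ... | yes _ = refl
    ... | no ≢  = contradiction refl ≢

    next-y : nextX (inj₂ (rev d₂)) ≡ inj₁ (M.next (rev d₁))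
    next-y with rev d₂ ≟D rev d₂
    ... | yes _ = refl
    ... | no ≢  = contradiction refl ≢

    next-else₁ : ∀ z → z ≢ rev d₁ → nextX (inj₁ z) ≡ inj₁ (M.next z)
    next-else₁ z ≢x with z ≟D rev d₁
    ... | yes p = contradiction p ≢x
    ... | no _  = refl

    next-else₂ : ∀ z → z ≢ rev d₂ → nextX (inj₂ z) ≡ inj₂ (P.next z)
    next-else₂ z ≢y with z ≟D rev d₂
    ... | yes p = contradiction p ≢y
    ... | no _  = refl

    rev-injective : ∀ {A} {z d : Dart A} → rev z ≡ rev d → z ≡ d
    rev-injective {z = z} {d} p = trans (sym (rev-rev z)) (trans (cong rev p) (rev-rev d))

    tailX : X → Fin (S₁ + s)
    tailX = glue hub ∘ Sum.map M.tail P.tail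

    faceX : X → Fin (F₁ + f)
    faceX = glue M.outer ∘ Sum.map M.face P.face

    revX : X → X
    revX = Sum.map rev rev

    nextX-orbits : IsOrbitLabelling nextX tailX
    nextX-orbits = glue-labelling _≟D_ _≟D_ M.next-orbits P.next-orbits refl root-head
      next-x next-y next-else₁ next-else₂

    walkX-orbits : IsOrbitLabelling (nextX ∘ revX) faceX
    walkX-orbits = glue-labelling _≟D_ _≟D_ M.walk-orbits P.walk-orbits M.start-outer root-face
      next-x next-y (λ z ≢x → next-else₁ (rev z) (≢x ∘ rev-injective))
      (λ z ≢y → next-else₂ (rev z) (≢y ∘ rev-injective))

    split : Dart (A₁ + A₂) → X
    split = splitDart

    onto : ∀ {n m} {r : Fin n} {ℓ₁ : Dart A₁ → Fin n} {ℓ₂ : Dart A₂ → Fin (suc m)} →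
      (∀ v → ∃ λ d → ℓ₁ d ≡ v) → (∀ v → ∃ λ d → ℓ₂ d ≡ v) →
      ∀ w → ∃ λ d → glue r (Sum.map ℓ₁ ℓ₂ (split d)) ≡ w
    onto {r = r} {ℓ₁} {ℓ₂} h₁ h₂ w with glue-onto r w
    ... | inj₁ u , refl with d , p ← h₁ u = joinDart (inj₁ d) ,
          cong (glue r) (trans (cong (Sum.map ℓ₁ ℓ₂) (splitDart-joinDart (inj₁ d))) (cong inj₁ p))
    ... | inj₂ v , refl with d , p ← h₂ v = joinDart (inj₂ d) ,
          cong (glue r) (trans (cong (Sum.map ℓ₁ ℓ₂) (splitDart-joinDart (inj₂ d))) (cong inj₂ p))

    complete′ : ∀ e → ∃ λ b → faceX (split (e , b)) ≡ M.outer Fin.↑ˡ f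
    complete′ e with Fin.splitAt A₁ e
    ... | inj₁ e₁ with b , p ← M.complete e₁ = b , cong (Fin._↑ˡ f) p
    ... | inj₂ e₂ with b , p ← P.complete e₂ = b , cong (glue M.outer ∘ inj₂) (trans p outer-zero)

    euler′ : S₁ + s + (F₁ + f) + 2 * (g₁ + g₂) ≡ A₁ + A₂ + 2
    euler′ = ℕP.+-cancelʳ-≡ 2 _ _ (begin
      S₁ + s + (F₁ + f) + 2 * (g₁ + g₂) + 2                 ≡⟨ regroup S₁ s F₁ f g₁ g₂ ⟩
      (S₁ + F₁ + 2 * g₁) + (suc s + suc f + 2 * g₂)         ≡⟨ cong₂ _+_ M.euler P.euler ⟩
      (A₁ + 2) + (A₂ + 2)                                   ≡⟨ regroup′ A₁ A₂ ⟩
      A₁ + A₂ + 2 + 2 ∎)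
      where
      open ≡-Reasoning
      open import Data.Nat.Tactic.RingSolver using (solve-∀)
      regroup : ∀ a b c d e f → a + b + (c + d) + 2 * (e + f) + 2 ≡ (a + c + 2 * e) + (suc b + suc d + 2 * f)
      regroup = solve-∀
      regroup′ : ∀ a b → (a + 2) + (b + 2) ≡ a + b + 2 + 2
      regroup′ = solve-∀

  wedge : Map (g₁ + g₂) (S₁ + s) (A₁ + A₂) (F₁ + f)
  wedge = record
    { tail        = tailX ∘ split
    ; next        = joinDart ∘ nextX ∘ split
    ; face        = faceX ∘ split
    ; outer       = M.outer Fin.↑ˡ f
    ; tail-onto   = onto M.tail-onto P.tail-onto
    ; face-onto   = onto M.face-onto P.face-onto
    ; next-orbits = transport-labelling nextX-orbits splitDart-injective λ d → splitDart-joinDart _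
    ; walk-orbits = transport-labelling walkX-orbits splitDart-injective λ d →
        trans (splitDart-joinDart _) (cong nextX (splitDart-rev d))
    ; complete    = complete′
    ; euler       = euler′
    }

  module _ (M-simple : IsSimple M) (P-simple : IsSimple P) where
    private
      module SM = IsSimple M-simple
      module SP = IsSimple P-simple

      inj₂-tail : ∀ (x y : Dart A₂) → tailX (inj₂ x) ≡ tailX (inj₂ y) → P.tail x ≡ P.tail y
      inj₂-tail x y p with glue-injective hub (inj₂ (P.tail x)) (inj₂ (P.tail y)) p
      ... | inj₁ q                     = inj₂-injective q
      ... | inj₂ (inj₂ q , inj₂ r)     = inj₂-injective (trans q (sym r))

      inj₁-tail : ∀ (x y : Dart A₁) → tailX (inj₁ x) ≡ tailX (inj₁ y) → M.tail x ≡ M.tail y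
      inj₁-tail x y = FinP.↑ˡ-injective s (M.tail x) (M.tail y)

      cross-tail : ∀ (x : Dart A₁) (y : Dart A₂) → tailX (inj₁ x) ≡ tailX (inj₂ y) → P.tail y ≡ zero
      cross-tail x y p with glue-injective hub (inj₁ (M.tail x)) (inj₂ (P.tail y)) p
      ... | inj₂ (_ , inj₂ r) = inj₂-injective r
      ... | inj₁ ()

      -- An edge of P parallel to an edge of M would have both ends at the gluing point.
      cross : ∀ (x : Dart A₁) (y : Dart A₂) →
        tailX (inj₁ x) ≡ tailX (inj₂ y) → tailX (revX (inj₁ x)) ≢ tailX (revX (inj₂ y))
      cross x y p q =
        SP.no-loop y (trans (cross-tail x y p) (sym (cross-tail (rev x) (rev y) q)))

      no-loopX : ∀ x → tailX x ≢ tailX (revX x)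
      no-loopX (inj₁ x) p = SM.no-loop x (inj₁-tail _ _ p)
      no-loopX (inj₂ x) p = SP.no-loop x (inj₂-tail _ _ p)

      no-parallelX : ∀ x y → tailX x ≡ tailX y → tailX (revX x) ≡ tailX (revX y) → x ≡ y
      no-parallelX (inj₁ x) (inj₁ y) p q =
        cong inj₁ (SM.no-parallel x y (inj₁-tail _ _ p) (inj₁-tail _ _ q))
      no-parallelX (inj₁ x) (inj₂ y) p q = contradiction q (cross x y p)
      no-parallelX (inj₂ x) (inj₁ y) p q = contradiction (sym q) (cross y x (sym p))
      no-parallelX (inj₂ x) (inj₂ y) p q =
        cong inj₂ (SP.no-parallel x y (inj₂-tail _ _ p) (inj₂-tail _ _ q))

    wedge-simple : IsSimple wedge
    wedge-simple = record
      { no-loop     = λ d p → no-loopX (split d) (trans p (cong tailX (splitDart-rev d)))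
      ; no-parallel = λ d d′ p q → splitDart-injective (no-parallelX (split d) (split d′) p
          (trans (cong tailX (sym (splitDart-rev d))) (trans q (cong tailX (splitDart-rev d′)))))
      }

-- The increment stands on the right so that the indices of `Wedge.wedge` match by computation;
-- `grow-≡` gives the closed form.
grow : ℕ → ℕ → ℕ → ℕ
grow k x zero    = x
grow k x (suc n) = grow k x n + k

grow-≡ : ∀ k x n → grow k x n ≡ x + n * k
grow-≡ k x zero    = sym (ℕP.+-identityʳ x)
grow-≡ k x (suc n) = trans (cong (λ y → y + k) (grow-≡ k x n))
  (trans (ℕP.+-assoc x (n * k) k) (cong (λ y → x + y) (ℕP.+-comm (n * k) k)))

bouquet : ∀ {g s A f} (P : Map g (suc s) A (suc f)) → Rooted P → IsSimple P → ∀ n →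
  Σ (Map (grow g g n) (grow s (suc s) n) (grow A A n) (grow f (suc f) n)) IsSimple
bouquet P rooted simple zero    = P , simple
bouquet P rooted simple (suc n) with M , M-simple ← bouquet P rooted simple n =
  Wedge.wedge M P rooted , Wedge.wedge-simple M P rooted M-simple simple

-- Maps from decidable data

-- The conditions in `Map` as a decidable proposition about its raw data. It certifies the two
-- concrete maps by computation and tests each code in the finite search.
Laws : ∀ g {S A F} → (Dart A → Fin S) → (Dart A → Dart A) → (Dart A → Fin F) → Fin F → Set
Laws g {S} {A} {F} tail next face outer =
  (∀ v → ∃ λ d → tail d ≡ v)
  × (∀ f → ∃ λ d → face d ≡ f)
  × IsOrbitLabelling next tail
  × IsOrbitLabelling (next ∘ rev) face
  × (∀ e → ∃ λ b → face (e , b) ≡ outer)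
  × S + F + 2 * g ≡ A + 2

laws? : ∀ g {S A F} (tail : Dart A → Fin S) (next : Dart A → Dart A) (face : Dart A → Fin F)
  (outer : Fin F) → Dec (Laws g tail next face outer)
laws? g tail next face outer =
  FinP.all? (λ v → anyDart? λ d → tail d FinP.≟ v)
  ×-dec FinP.all? (λ f → anyDart? λ d → face d FinP.≟ f)
  ×-dec orbitLabelling? next tail
  ×-dec orbitLabelling? (next ∘ rev) face
  ×-dec FinP.all? (λ e → anyBool? λ b → face (e , b) FinP.≟ outer)
  ×-dec _ ℕP.≟ _
  where
  anyBool? : ∀ {P : Bool → Set} → Decidable P → Dec (∃ P)
  anyBool? P? = map′
    (λ { (inj₁ p) → true , p ; (inj₂ p) → false , p })
    (λ { (true , p) → inj₁ p ; (false , p) → inj₂ p })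
    (P? true ⊎-dec P? false)

fromLaws : ∀ {g S A F tail next face outer} → Laws g {S} {A} {F} tail next face outer → Map g S A F
fromLaws {tail = tail} {next} {face} {outer} (t , f , n , w , c , e) = record
  { tail = tail ; next = next ; face = face ; outer = outer ; tail-onto = t ; face-onto = f
  ; next-orbits = n ; walk-orbits = w ; complete = c ; euler = e }

map-laws : ∀ {g S A F} (M : Map g S A F) → let open Map M in Laws g tail next face outer
map-laws M = tail-onto , face-onto , next-orbits , walk-orbits , complete , euler
  where open Map M

laws-cong : ∀ {g S A F} {tail tail′ : Dart A → Fin S} {next next′ : Dart A → Dart A}
  {face face′ : Dart A → Fin F} {outer} →
  (∀ d → tail d ≡ tail′ d) → (∀ d → next d ≡ next′ d) → (∀ d → face d ≡ face′ d) →
  Laws g tail next face outer → Laws g tail′ next′ face′ outer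
laws-cong p q r (t , f , n , w , c , e) =
  (λ v → let d , s = t v in d , trans (sym (p d)) s)
  , (λ v → let d , s = f v in d , trans (sym (r d)) s)
  , orbitLabelling-cong q p n
  , orbitLabelling-cong (q ∘ rev) r w
  , (λ v → let b , s = c v in b , trans (sym (r _)) s)
  , e

simple? : ∀ {g S A F} (M : Map g S A F) → Dec (IsSimple M)
simple? M = map′
  (λ (l , p) → record { no-loop = l ; no-parallel = p })
  (λ s → IsSimple.no-loop s , IsSimple.no-parallel s)
  ((allDarts? λ d → ¬? (tail d FinP.≟ tail (rev d)))
   ×-dec (allDarts? λ d → allDarts? λ d′ →
     (tail d FinP.≟ tail d′) →-dec (tail (rev d) FinP.≟ tail (rev d′)) →-dec (d ≟D d′)))
  where open Map M

-- Two small maps given by tables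

module Tables {S A F : ℕ} (ends : Vec (Fin S × Fin S) A) (next : Vec (Dart A × Dart A) A)
              (face : Vec (Fin F × Fin F) A) where

  select : ∀ {X : Set} → X × X → Bool → X
  select p true  = proj₁ p
  select p false = proj₂ p

  tailT : Dart A → Fin S
  tailT (e , b) = select (Vec.lookup ends e) b

  nextT : Dart A → Dart A
  nextT (e , b) = select (Vec.lookup next e) b

  faceT : Dart A → Fin F
  faceT (e , b) = select (Vec.lookup face e) b

module Triangle where
  open import Data.Vec using ([]; _∷_)
  open Tables {3} {3} {2}
    ((# 0 , # 1) ∷ (# 1 , # 2) ∷ (# 2 , # 0) ∷ [])
    (((# 2 , false) , (# 1 , true)) ∷ ((# 0 , false) , (# 2 , true)) ∷ ((# 1 , false) , (# 0 , true)) ∷ [])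
    ((# 0 , # 1) ∷ (# 0 , # 1) ∷ (# 0 , # 1) ∷ [])

  triangle : Map 0 3 3 2
  triangle = fromLaws (from-yes (laws? 0 tailT nextT faceT zero))

  triangle-rooted : Rooted triangle
  triangle-rooted = record { root = # 2 , true ; root-face = refl ; root-head = refl ; outer-zero = refl }

  triangle-simple : IsSimple triangle
  triangle-simple = from-yes (simple? triangle)

open Triangle using (triangle; triangle-rooted; triangle-simple)

-- The wheel on four rim vertices: two triangles sharing the hub form a planar cactus, and the
-- two remaining rim edges cross in its outer face, which raises the genus by one.
module Wheel where
  open import Data.Vec using ([]; _∷_)
  open Tables {5} {8} {3}
    ((# 0 , # 1) ∷ (# 1 , # 2) ∷ (# 2 , # 0) ∷ (# 0 , # 3) ∷ (# 3 , # 4) ∷ (# 4 , # 0) ∷ (# 1 , # 3) ∷ (# 2 , # 4) ∷ [])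
    (((# 2 , false) , (# 6 , true)) ∷ ((# 0 , false) , (# 7 , true)) ∷ ((# 1 , false) , (# 3 , true)) ∷ ((# 5 , false) , (# 6 , false))
     ∷ ((# 3 , false) , (# 7 , false)) ∷ ((# 4 , false) , (# 0 , true)) ∷ ((# 1 , true) , (# 4 , true)) ∷ ((# 2 , true) , (# 5 , true)) ∷ [])
    ((# 0 , # 1) ∷ (# 0 , # 1) ∷ (# 0 , # 1) ∷ (# 0 , # 2) ∷ (# 0 , # 2) ∷ (# 0 , # 2) ∷ (# 0 , # 0) ∷ (# 0 , # 0) ∷ [])

  wheel : Map 1 5 8 3
  wheel = fromLaws (from-yes (laws? 1 tailT nextT faceT zero))

  wheel-rooted : Rooted wheel
  wheel-rooted = record { root = # 2 , true ; root-face = refl ; root-head = refl ; outer-zero = refl }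

  wheel-simple : IsSimple wheel
  wheel-simple = from-yes (simple? wheel)

open Wheel using (wheel; wheel-rooted; wheel-simple)

-- Fractions of natural numbers

-- `_/_` reduces to lowest terms, so comparisons, sums and products are carried to unnormalised
-- fractions, where no common divisor intervenes.
toℚᵘ-/ : ∀ a b .{{_ : NonZero b}} → toℚᵘ (+ a / b) ℚᵘ.≃ (+ a ℚᵘ./ b)
toℚᵘ-/ a (suc b) = ℚP.toℚᵘ-fromℚᵘ (mkℚᵘ (+ a) b)

/-≤ : ∀ {a b c d} .{{_ : NonZero b}} .{{_ : NonZero d}} → a * d ≤ c * b → + a / b ℚ.≤ + c / d
/-≤ {a} {suc b} {c} {suc d} le = ℚP.toℚᵘ-cancel-≤
  (ℚᵘP.≤-respˡ-≃ (ℚᵘP.≃-sym (toℚᵘ-/ a (suc b))) (ℚᵘP.≤-respʳ-≃ (ℚᵘP.≃-sym (toℚᵘ-/ c (suc d)))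
    (*≤* (subst₂ ℤ._≤_ (ℤP.pos-* a (suc d)) (ℤP.pos-* c (suc b)) (ℤ.+≤+ le)))))

/-< : ∀ {a b c d} .{{_ : NonZero b}} .{{_ : NonZero d}} → a * d ℕ.< c * b → + a / b ℚ.< + c / d
/-< {a} {suc b} {c} {suc d} lt = ℚP.toℚᵘ-cancel-<
  (ℚᵘP.<-respˡ-≃ (ℚᵘP.≃-sym (toℚᵘ-/ a (suc b))) (ℚᵘP.<-respʳ-≃ (ℚᵘP.≃-sym (toℚᵘ-/ c (suc d)))
    (*<* (subst₂ ℤ._<_ (ℤP.pos-* a (suc d)) (ℤP.pos-* c (suc b)) (ℤ.+<+ lt)))))

/-≡ : ∀ {a b c d} .{{_ : NonZero b}} .{{_ : NonZero d}} → a * d ≡ c * b → + a / b ≡ + c / d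
/-≡ {a} {b} {c} {d} eq = ℚP.≤-antisym (/-≤ {a} {b} {c} {d} (ℕP.≤-reflexive eq))
                                       (/-≤ {c} {d} {a} {b} (ℕP.≤-reflexive (sym eq)))

/-+ : ∀ a b c d .{{_ : NonZero b}} .{{_ : NonZero d}} .{{_ : NonZero (b * d)}} →
  (+ a / b) ℚ.+ (+ c / d) ≡ + (a * d + c * b) / (b * d)
/-+ a b@(suc _) c d@(suc _) = ℚP.toℚᵘ-injective (begin
  toℚᵘ ((+ a / b) ℚ.+ (+ c / d))          ≈⟨ ℚP.toℚᵘ-homo-+ (+ a / b) (+ c / d) ⟩
  toℚᵘ (+ a / b) ℚᵘ.+ toℚᵘ (+ c / d)      ≈⟨ ℚᵘP.+-cong (toℚᵘ-/ a b) (toℚᵘ-/ c d) ⟩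
  (+ a ℚᵘ./ b) ℚᵘ.+ (+ c ℚᵘ./ d)          ≡⟨ cong (ℚᵘ._/ (b * d)) (cong₂ ℤ._+_ (sym (ℤP.pos-* a d)) (sym (ℤP.pos-* c b))) ⟩
  (+ (a * d + c * b)) ℚᵘ./ (b * d)        ≈⟨ toℚᵘ-/ (a * d + c * b) (b * d) ⟨
  toℚᵘ (+ (a * d + c * b) / (b * d)) ∎)
  where open ℚᵘP.≃-Reasoning

/-* : ∀ a b c d .{{_ : NonZero b}} .{{_ : NonZero d}} .{{_ : NonZero (b * d)}} →
  (+ a / b) ℚ.* (+ c / d) ≡ + (a * c) / (b * d)
/-* a b@(suc _) c d@(suc _) = ℚP.toℚᵘ-injective (begin
  toℚᵘ ((+ a / b) ℚ.* (+ c / d))          ≈⟨ ℚP.toℚᵘ-homo-* (+ a / b) (+ c / d) ⟩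
  toℚᵘ (+ a / b) ℚᵘ.* toℚᵘ (+ c / d)      ≈⟨ ℚᵘP.*-cong (toℚᵘ-/ a b) (toℚᵘ-/ c d) ⟩
  (+ a ℚᵘ./ b) ℚᵘ.* (+ c ℚᵘ./ d)          ≡⟨ cong (ℚᵘ._/ (b * d)) (sym (ℤP.pos-* a c)) ⟩
  (+ (a * c)) ℚᵘ./ (b * d)                ≈⟨ toℚᵘ-/ (a * c) (b * d) ⟨
  toℚᵘ (+ (a * c) / (b * d)) ∎)
  where open ℚᵘP.≃-Reasoning

/-minus-1 : ∀ n d .{{_ : NonZero d}} → (+ (d + n) / d) ℚ.- ℚ.1ℚ ≡ + n / d
/-minus-1 n d@(suc d-1) = begin
  (+ (d + n) / d) ℚ.- ℚ.1ℚ                ≡⟨ cong (ℚ._- ℚ.1ℚ) (/-≡ {d + n} {d} {n * 1 + 1 * d} {d * 1} (crossed d n)) ⟩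
  (+ (n * 1 + 1 * d) / (d * 1)) ℚ.- ℚ.1ℚ  ≡⟨ cong (ℚ._- ℚ.1ℚ) (/-+ n d 1 1) ⟨
  (+ n / d) ℚ.+ ℚ.1ℚ ℚ.- ℚ.1ℚ             ≡⟨ ℚP.+-assoc (+ n / d) ℚ.1ℚ (ℚ.- ℚ.1ℚ) ⟩
  (+ n / d) ℚ.+ (ℚ.1ℚ ℚ.- ℚ.1ℚ)           ≡⟨ cong ((+ n / d) ℚ.+_) (ℚP.+-inverseʳ ℚ.1ℚ) ⟩
  (+ n / d) ℚ.+ ℚ.0ℚ                      ≡⟨ ℚP.+-identityʳ (+ n / d) ⟩
  + n / d ∎
  where
  open ≡-Reasoning
  crossed : ∀ d n → (d + n) * (d * 1) ≡ (n * 1 + 1 * d) * d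
  crossed = solve-∀

-- Integer square roots

if-dec : ∀ {A Q : Set} (P : A → Set) (Q? : Dec Q) {x y : A} →
  (Q → P x) → (¬ Q → P y) → P (if does Q? then x else y)
if-dec P (yes q) p _ = p q
if-dec P (no ¬q) _ p = p ¬q

isqrt-spec : ∀ n → isqrt n * isqrt n ≤ n × n ℕ.< suc (isqrt n) * suc (isqrt n)
isqrt-spec zero    = ℕ.z≤n , ℕ.s≤s ℕ.z≤n
isqrt-spec (suc n) = let r = isqrt n ; lo , hi = isqrt-spec n in
  if-dec (λ s → s * s ≤ suc n × suc n ℕ.< suc s * suc s) (suc r * suc r ℕ.≤? suc n)
    (λ p → p , ℕP.≤-<-trans hi (ℕP.*-mono-< (ℕP.n<1+n (suc r)) (ℕP.n<1+n (suc r))))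
    (λ ¬p → ℕP.m≤n⇒m≤1+n lo , ℕP.≰⇒> ¬p)

square-cancel-≤ : ∀ {m n} → m * m ℕ.< suc n * suc n → m ≤ n
square-cancel-≤ {m} {n} lt = ℕ.s≤s⁻¹ (ℕP.≰⇒> λ le → ℕP.<⇒≱ lt (ℕP.*-mono-≤ le le))

≤isqrt : ∀ {k m} → k * k ≤ m → k ≤ isqrt m
≤isqrt {k} {m} le = square-cancel-≤ (ℕP.≤-<-trans le (proj₂ (isqrt-spec m)))

csqrt-upper : ∀ m → m ≤ csqrt m * csqrt m
csqrt-upper m = if-dec (λ c → m ≤ c * c) (isqrt m * isqrt m ℕ.≟ m)
  (λ p → ℕP.≤-reflexive (sym p)) (λ _ → ℕP.<⇒≤ (proj₂ (isqrt-spec m)))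

csqrt≤ : ∀ {k m} → m ≤ k * k → csqrt m ≤ k
csqrt≤ {k} {m} le = if-dec (_≤ k) (isqrt m * isqrt m ℕ.≟ m)
  (λ p → square-cancel-≤ (ℕP.≤-<-trans (ℕP.≤-trans (ℕP.≤-reflexive p) le)
           (ℕP.*-mono-< (ℕP.n<1+n k) (ℕP.n<1+n k))))
  (λ ¬p → ℕP.≰⇒> λ k≤ → ¬p (ℕP.≤-antisym (proj₁ (isqrt-spec m))
            (ℕP.≤-trans le (ℕP.*-mono-≤ k≤ k≤))))

-- If `2 + isqrt m` has the wrong parity it differs from `s`, and the bound `s ≤ 2 + isqrt m`
-- improves by one.
≤floorPar : ∀ {s j m} → s % 2 ≡ j → (s ∸ 2) * (s ∸ 2) ≤ m → s ≤ floorPar j m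
≤floorPar {s} {j} {m} par le = if-dec (s ≤_) ((2 + isqrt m) % 2 ℕ.≟ j)
  (λ _ → below)
  (λ ¬p → ℕ.s≤s⁻¹ (ℕP.≤∧≢⇒< below λ s≡ → ¬p (trans (cong (_% 2) (sym s≡)) par)))
  where
  below : s ≤ 2 + isqrt m
  below = ℕP.≤-trans (ℕP.m≤n+m∸n s 2) (ℕP.+-monoʳ-≤ 2 (≤isqrt le))

floorPar-bounds : ∀ j m → 1 + isqrt m ≤ floorPar j m × floorPar j m ≤ 2 + isqrt m
floorPar-bounds j m = if-dec (λ f → 1 + isqrt m ≤ f × f ≤ 2 + isqrt m) ((2 + isqrt m) % 2 ℕ.≟ j)
  (λ _ → ℕP.n≤1+n _ , ℕP.≤-refl) (λ _ → ℕP.≤-refl , ℕP.n≤1+n _)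

ceilPar≤ : ∀ {s j m} → s % 2 ≡ j → 2 ≤ s → m ≤ (s ∸ 2) * (s ∸ 2) → ceilPar j m ≤ s
ceilPar≤ {s} {j} {m} par 2≤s le = if-dec (λ c → suc c ≤ s) ((2 + csqrt m) % 2 ℕ.≟ j)
  (λ _ → below)
  (λ ¬p → ℕP.≤∧≢⇒< below λ ≡s → ¬p (trans (cong (_% 2) ≡s) par))
  where
  below : 2 + csqrt m ≤ s
  below = subst (2 + csqrt m ≤_) (ℕP.m+[n∸m]≡n 2≤s) (ℕP.+-monoʳ-≤ 2 (csqrt≤ le))

ceilPar-lower : ∀ j m → ∃ λ c → ceilPar j m ≡ 2 + c × m ≤ c * c
ceilPar-lower j m = if-dec (λ k → ∃ λ c → suc k ≡ 2 + c × m ≤ c * c) ((2 + csqrt m) % 2 ℕ.≟ j)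
  (λ _ → csqrt m , refl , csqrt-upper m)
  (λ _ → suc (csqrt m) , refl ,
    ℕP.≤-trans (csqrt-upper m) (ℕP.*-mono-≤ (ℕP.n≤1+n (csqrt m)) (ℕP.n≤1+n (csqrt m))))

private
  minus-1 : ∀ f → (+ suc f / 1) ℚ.- ℚ.1ℚ ≡ + f / 1
  minus-1 f = /-minus-1 f 1

  3+ : ∀ n C .{{_ : NonZero C}} → (+ 3 / 1) ℚ.+ (+ n / C) ≡ + (3 * C + n) / C
  3+ n C@(suc _) = trans (/-+ 3 1 n C) (/-≡ {3 * C + n * 1} {1 * C} {3 * C + n} {C} (crossed C n))
    where
    crossed : ∀ C n → (3 * C + n * 1) * C ≡ (3 * C + n) * (1 * C)
    crossed = solve-∀

-- b_r ≤ b

LeB-fraction : ∀ q g n d .{{_ : NonZero d}} → q ℚ.- ℚ.1ℚ ≡ + n / d →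
  n * n ≤ (1 + 6 * g) * (d * d) → LeB q g
LeB-fraction q g n d@(suc _) eq le = inj₂ (subst (λ r → r ℚ.* r ℚ.≤ + (1 + 6 * g) / 1) (sym eq)
  (subst (ℚ._≤ + (1 + 6 * g) / 1) (sym (/-* n d n d))
    (/-≤ {n * n} {d * d} {1 + 6 * g} {1}
      (subst (_≤ (1 + 6 * g) * (d * d)) (sym (ℕP.*-identityʳ (n * n))) le))))

LeB-floor : ∀ {g m} f → 1 ≤ m → m ≤ 1 + 6 * g → 1 + isqrt m ≤ f → f ≤ 2 + isqrt m →
  LeB ((+ f / 1) ℚ.- ℚ.1ℚ) g
LeB-floor {m = m} (suc zero) 1≤m _ (ℕ.s≤s r≤0) _ =
  contradiction (ℕP.≤-trans (≤isqrt {1} {m} 1≤m) r≤0) λ ()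
LeB-floor {g} {m} (suc (suc f)) _ m≤ _ (ℕ.s≤s (ℕ.s≤s f≤)) =
  LeB-fraction ((+ suc (suc f) / 1) ℚ.- ℚ.1ℚ) g f 1
    (trans (cong (ℚ._- ℚ.1ℚ) (minus-1 (suc f))) (minus-1 f))
    (ℕP.≤-trans (ℕP.*-mono-≤ f≤ f≤) (ℕP.≤-trans (proj₁ (isqrt-spec m))
      (ℕP.≤-trans m≤ (ℕP.≤-reflexive (sym (ℕP.*-identityʳ (1 + 6 * g)))))))

-- With m = 4 + n and C = 2 + c ≥ 2 + √m, the value (2C + n)/C is at most √m, because
-- m C² − (2C + n)² = n (c² − m).
LeB-ceil : ∀ {g n} c → 4 + n ≤ 1 + 6 * g → 4 + n ≤ c * c →
  LeB ((+ 3 / 1) ℚ.+ (+ n / (2 + c))) g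
LeB-ceil {g} {n} c m≤ m≤c² = LeB-fraction ((+ 3 / 1) ℚ.+ (+ n / C)) g (2 * C + n) C
  (trans (cong (ℚ._- ℚ.1ℚ) (trans (3+ n C) (cong (λ k → + k / C) (assoc C n)))) (/-minus-1 (2 * C + n) C))
  (ℕP.≤-trans square≤ (ℕP.*-monoˡ-≤ (C * C) m≤))
  where
  C = 2 + c
  assoc : ∀ C n → 3 * C + n ≡ C + (2 * C + n)
  assoc = solve-∀
  identity : ∀ c n → (2 * (2 + c) + n) * (2 * (2 + c) + n) + n * (c * c)
                   ≡ (4 + n) * ((2 + c) * (2 + c)) + n * (4 + n)
  identity = solve-∀
  square≤ : (2 * C + n) * (2 * C + n) ≤ (4 + n) * (C * C)
  square≤ = ℕP.+-cancelʳ-≤ (n * (4 + n)) _ _ (ℕP.≤-trans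
    (ℕP.+-monoʳ-≤ ((2 * C + n) * (2 * C + n)) (ℕP.*-monoʳ-≤ n m≤c²)) (ℕP.≤-reflexive (identity c n)))

LeB-⊔ : ∀ p q g → LeB p g → LeB q g → LeB (p ℚ.⊔ q) g
LeB-⊔ p q g P Q = Sum.[ (λ eq → subst (λ r → LeB r g) (sym eq) P)
                      , (λ eq → subst (λ r → LeB r g) (sym eq) Q) ]′ (ℚP.⊔-sel p q)

LeB-ceilPar : ∀ {g n} j m → 4 + n ≡ m → m ≤ 1 + 6 * g →
  LeB ((+ 3 / 1) ℚ.+ (+ n / ceilPar j m)) g
LeB-ceilPar {g} {n} j m refl m≤ = along (ceilPar-lower j m)
  where
  -- The denominator becomes a variable so that its equation with `2 + c` can be matched.
  along : ∀ {C} .{{_ : NonZero C}} → (∃ λ c → C ≡ 2 + c × m ≤ c * c) →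
    LeB ((+ 3 / 1) ℚ.+ (+ n / C)) g
  along (c , refl , m≤c²) = LeB-ceil {g} {n} c m≤ m≤c²

6≤6g : ∀ {g} → 1 ≤ g → 6 ≤ 6 * g
6≤6g 1≤g = ℕP.*-monoʳ-≤ 6 1≤g

module BrParts (g : ℕ) where

  f₀ f₁ c₀ c₁ : ℚ
  f₀ = (+ floorPar 0 (6 * g) / 1) ℚ.- ℚ.1ℚ
  f₁ = (+ floorPar 1 (6 * g + 1) / 1) ℚ.- ℚ.1ℚ
  c₀ = (+ 3 / 1) ℚ.+ (+ (6 * g ∸ 4) / ceilPar 0 (6 * g))
  c₁ = (+ 3 / 1) ℚ.+ (+ (6 * g ∸ 3) / ceilPar 1 (6 * g + 1))

  f₀≤br : f₀ ℚ.≤ br g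
  f₀≤br = ℚP.p≤q⇒p≤q⊔r {f₀ ℚ.⊔ f₁ ℚ.⊔ c₀} {f₀} c₁
    (ℚP.p≤q⇒p≤q⊔r {f₀ ℚ.⊔ f₁} {f₀} c₀ (ℚP.p≤p⊔q f₀ f₁))

  f₁≤br : f₁ ℚ.≤ br g
  f₁≤br = ℚP.p≤q⇒p≤q⊔r {f₀ ℚ.⊔ f₁ ℚ.⊔ c₀} {f₁} c₁
    (ℚP.p≤q⇒p≤q⊔r {f₀ ℚ.⊔ f₁} {f₁} c₀ (ℚP.p≤q⊔p f₀ f₁))

  c₀≤br : c₀ ℚ.≤ br g
  c₀≤br = ℚP.p≤q⇒p≤q⊔r {f₀ ℚ.⊔ f₁ ℚ.⊔ c₀} {c₀} c₁ (ℚP.p≤q⊔p (f₀ ℚ.⊔ f₁) c₀)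

  c₁≤br : c₁ ℚ.≤ br g
  c₁≤br = ℚP.p≤q⊔p (f₀ ℚ.⊔ f₁ ℚ.⊔ c₀) c₁

br≤b : ∀ g → 1 ≤ g → LeB (br g) g
br≤b g 1≤g =
  LeB-⊔ (f₀ ℚ.⊔ f₁ ℚ.⊔ c₀) c₁ g (LeB-⊔ (f₀ ℚ.⊔ f₁) c₀ g (LeB-⊔ f₀ f₁ g
    (floor 0 (6 * g) 6≤ (ℕP.n≤1+n _))
    (floor 1 (6 * g + 1) (ℕP.m≤n⇒m≤n+o 1 6≤) (ℕP.≤-reflexive (ℕP.+-comm (6 * g) 1))))
    (LeB-ceilPar {g} 0 (6 * g) (ℕP.m+[n∸m]≡n (ℕP.≤-trans (ℕP.m≤m+n 4 2) 6≤)) (ℕP.n≤1+n (6 * g))))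
    (LeB-ceilPar {g} 1 (6 * g + 1)
      (trans (cong suc (ℕP.m+[n∸m]≡n (ℕP.≤-trans (ℕP.m≤m+n 3 3) 6≤))) (ℕP.+-comm 1 (6 * g)))
      (ℕP.≤-reflexive (ℕP.+-comm (6 * g) 1)))
  where
  open BrParts g
  6≤ : 6 ≤ 6 * g
  6≤ = 6≤6g 1≤g
  floor : ∀ j m → 6 ≤ m → m ≤ 1 + 6 * g → LeB ((+ floorPar j m / 1) ℚ.- ℚ.1ℚ) g
  floor j m 6≤m m≤ = let lo , hi = floorPar-bounds j m in
    LeB-floor {g} {m} (floorPar j m) (ℕP.≤-trans (ℕ.s≤s ℕ.z≤n) 6≤m) m≤ lo hi

-- The valence is at most b_r

module _ {S R : ℕ} .{{_ : NonZero S}} where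

  ratio≤floor : ∀ {j m} → S % 2 ≡ j → R + (R + S) ≤ S * S → (S ∸ 2) * (S ∸ 2) ≤ m →
    + (2 * R) / S ℚ.≤ (+ floorPar j m / 1) ℚ.- ℚ.1ℚ
  ratio≤floor {j} {m} par complete le = below (floorPar j m) (≤floorPar par le)
    where
    below : ∀ f → S ≤ f → + (2 * R) / S ℚ.≤ (+ f / 1) ℚ.- ℚ.1ℚ
    below zero    S≤0 = contradiction (ℕP.n≤0⇒n≡0 S≤0) (ℕ.≢-nonZero⁻¹ S)
    below (suc f) S≤f = subst (+ (2 * R) / S ℚ.≤_) (sym (minus-1 f)) (/-≤ {2 * R} {S} {f} {1}
      (ℕP.+-cancelʳ-≤ S _ _ (begin
        2 * R * 1 + S ≡⟨ solve (R ∷ S ∷ []) ⟩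
        R + (R + S)   ≤⟨ complete ⟩
        S * S         ≤⟨ ℕP.*-monoˡ-≤ S S≤f ⟩
        S + f * S     ≡⟨ ℕP.+-comm S (f * S) ⟩
        f * S + S ∎)))
      where open ℕP.≤-Reasoning

  ratio≤ceil : ∀ {n C} .{{_ : NonZero C}} → C ≤ S → 2 * R ≤ 3 * S + n →
    + (2 * R) / S ℚ.≤ (+ 3 / 1) ℚ.+ (+ n / C)
  ratio≤ceil {n} {C} C≤S le = subst (+ (2 * R) / S ℚ.≤_) (sym (3+ n C))
    (/-≤ {2 * R} {S} {3 * C + n} {C} (begin
      2 * R * C             ≤⟨ ℕP.*-monoˡ-≤ C le ⟩
      (3 * S + n) * C       ≡⟨ ℕP.*-distribʳ-+ C (3 * S) n ⟩
      3 * S * C + n * C     ≤⟨ ℕP.+-monoʳ-≤ (3 * S * C) (ℕP.*-monoʳ-≤ n C≤S) ⟩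
      3 * S * C + n * S     ≡⟨ solve (S ∷ C ∷ n ∷ []) ⟩
      (3 * C + n) * S ∎))
    where open ℕP.≤-Reasoning

  -- The cases are divided at S - 2 = √m. Up to there the bound S - 1 is used, which is largest at
  -- the rounded-down point; beyond it the bound 3 + n/S, which is largest at the rounded-up point.
  ratio≤ : ∀ n j m → S % 2 ≡ j → R + (R + S) ≤ S * S → 2 * R ≤ 3 * S + n →
    + (2 * R) / S ℚ.≤ (+ floorPar j m / 1) ℚ.- ℚ.1ℚ
    ⊎ + (2 * R) / S ℚ.≤ (+ 3 / 1) ℚ.+ (+ n / ceilPar j m)
  ratio≤ n j m par complete le = Sum.map (ratio≤floor {j} {m} par complete)
    (λ large → ratio≤ceil {n} {ceilPar j m}
      (ceilPar≤ {S} {j} {m} par (2≤S large) (ℕP.<⇒≤ large)) le)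
    (ℕP.≤-<-connex ((S ∸ 2) * (S ∸ 2)) m)
    where
    2≤S : m ℕ.< (S ∸ 2) * (S ∸ 2) → 2 ≤ S
    2≤S large = ℕP.≮⇒≥ λ S<2 →
      ℕP.n≮0 (subst (λ k → m ℕ.< k * k) (ℕP.m≤n⇒m∸n≡0 (ℕP.<⇒≤ S<2)) large)

-- For even S the number 2R + 3 is odd and 3S + 6g is even, so equality is impossible and one unit
-- is gained. This is the difference between 6g - 3 and 6g - 4 in `br`.
even-gap : ∀ {R S g} → S % 2 ≡ 0 → 2 * R + 3 ≤ 3 * S + 6 * g → 2 * R + 4 ≤ 3 * S + 6 * g
even-gap {R} {S} {g} par le = subst (_≤ 3 * S + 6 * g) (sym (ℕP.+-suc (2 * R) 3)) (ℕP.≤∧≢⇒< le odd≢even)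
  where
  t = S ℕ./ 2
  S≡ : S ≡ t * 2
  S≡ = trans (DivMod.m≡m%n+[m/n]*n S 2) (cong (_+ t * 2) par)
  odd : ∀ k → (2 * k + 3) % 2 ≡ 1
  odd k = trans (cong (_% 2) (shape k)) (DivMod.[m+kn]%n≡m%n 1 (k + 1) 2)
    where
    shape : ∀ k → 2 * k + 3 ≡ 1 + (k + 1) * 2
    shape = solve-∀
  even : ∀ t → (3 * (t * 2) + 6 * g) % 2 ≡ 0
  even t = trans (cong (_% 2) (shape t g)) (DivMod.[m+kn]%n≡m%n 0 (3 * t + 3 * g) 2)
    where
    shape : ∀ t g → 3 * (t * 2) + 6 * g ≡ 0 + (3 * t + 3 * g) * 2
    shape = solve-∀
  odd≢even : 2 * R + 3 ≢ 3 * S + 6 * g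
  odd≢even eq with () ← trans (sym (odd R))
    (trans (cong (_% 2) (trans eq (cong (λ s → 3 * s + 6 * g) S≡))) (even t))

cancel-∸ : ∀ k {x y z} → k ≤ z → x + k ≤ y + z → x ≤ y + (z ∸ k)
cancel-∸ k {x} {y} {z} k≤z le = ℕP.+-cancelʳ-≤ k x (y + (z ∸ k)) (subst (x + k ≤_)
  (trans (cong (λ w → y + w) (sym (ℕP.m∸n+n≡m k≤z))) (sym (ℕP.+-assoc y (z ∸ k) k))) le)

ratio≤br : ∀ g {S R} .{{_ : NonZero S}} → 1 ≤ g → R + (R + S) ≤ S * S → 2 * R + 3 ≤ 3 * S + 6 * g →
  + (2 * R) / S ℚ.≤ br g
ratio≤br g {S} {R} 1≤g complete euler = by-parity (S % 2) refl (DivMod.m%n<n S 2)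
  where
  open BrParts g
  q = + (2 * R) / S
  by-parity : ∀ j → S % 2 ≡ j → j ℕ.< 2 → q ℚ.≤ br g
  by-parity 0 par _ = Sum.[ (λ le → ℚP.≤-trans {q} {f₀} {br g} le f₀≤br)
                          , (λ le → ℚP.≤-trans {q} {c₀} {br g} le c₀≤br) ]
    (ratio≤ {S} {R} (6 * g ∸ 4) 0 (6 * g) par complete
      (cancel-∸ 4 (ℕP.≤-trans (ℕP.m≤m+n 4 2) (6≤6g 1≤g)) (even-gap {R} {S} {g} par euler)))
  by-parity 1 par _ = Sum.[ (λ le → ℚP.≤-trans {q} {f₁} {br g} le f₁≤br)
                          , (λ le → ℚP.≤-trans {q} {c₁} {br g} le c₁≤br) ]
    (ratio≤ {S} {R} (6 * g ∸ 3) 1 (6 * g + 1) par complete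
      (cancel-∸ 3 (ℕP.≤-trans (ℕP.m≤m+n 3 3) (6≤6g 1≤g)) euler))
  by-parity (suc (suc _)) _ (ℕ.s≤s (ℕ.s≤s ()))

-- Comparison of valences with those of the bouquets

lower-bound : ∀ h {R} → 8 + h * 8 ≤ R → + (12 * suc h) / suc (3 * suc h) ℚ.≤ + (2 * R) / (5 + h * 4)
lower-bound h {R} le = /-≤ {12 * suc h} {suc (3 * suc h)} {2 * R} {5 + h * 4} (begin
  -- With g = h + 1, the slack is 16g (3g + 1) - 12g (4g + 1) = 4g.
  12 * suc h * (5 + h * 4)                       ≤⟨ ℕP.m≤m+n _ (4 * suc h) ⟩
  12 * suc h * (5 + h * 4) + 4 * suc h           ≡⟨ solve (h ∷ []) ⟩
  2 * (8 + h * 8) * suc (3 * suc h)              ≤⟨ ℕP.*-monoˡ-≤ (suc (3 * suc h)) (ℕP.*-monoʳ-≤ 2 le) ⟩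
  2 * R * suc (3 * suc h) ∎)
  where open ℕP.≤-Reasoning

-- A bound 3 + 6g/S falls below the valence 4 − 4/(4g+1) of the bouquet of g wheels.
many-vertices : ∀ h {R S R′} .{{_ : NonZero S}} → 8 + h * 8 ≤ R → 2 * R′ + 3 ≤ 3 * S + 6 * suc h →
  6 * suc h * (5 + h * 4) ≤ S → + (2 * R′) / S ℚ.≤ + (2 * R) / (5 + h * 4)
many-vertices h {R} {S} {R′} le euler large = /-≤ {2 * R′} {S} {2 * R} {5 + h * 4} (begin
  2 * R′ * (5 + h * 4)                                ≤⟨ ℕP.*-monoˡ-≤ (5 + h * 4) (ℕP.m+n≤o⇒m≤o (2 * R′) euler) ⟩
  (3 * S + 6 * suc h) * (5 + h * 4)                   ≡⟨ ℕP.*-distribʳ-+ (5 + h * 4) (3 * S) (6 * suc h) ⟩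
  3 * S * (5 + h * 4) + 6 * suc h * (5 + h * 4)       ≤⟨ ℕP.+-monoʳ-≤ (3 * S * (5 + h * 4)) large ⟩
  3 * S * (5 + h * 4) + S                             ≤⟨ ℕP.m≤m+n _ (4 * h * S) ⟩
  3 * S * (5 + h * 4) + S + 4 * h * S                 ≡⟨ solve (h ∷ S ∷ []) ⟩
  2 * (8 + h * 8) * S                                 ≤⟨ ℕP.*-monoˡ-≤ S (ℕP.*-monoʳ-≤ 2 le) ⟩
  2 * R * S ∎)
  where open ℕP.≤-Reasoning

-- The summand 0 is what `6 * g` becomes in genus zero. The 3 on the left then makes the inequality
-- strict, so the value 3 is never attained.
ratio<3 : ∀ {R S} .{{_ : NonZero S}} → 2 * R + 3 ≤ 3 * S + 0 → + (2 * R) / S ℚ.< + 3 / 1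
ratio<3 {R} {S} le = /-< {2 * R} {S} {3} {1} (begin-strict
  2 * R * 1     ≡⟨ ℕP.*-identityʳ (2 * R) ⟩
  2 * R         <⟨ ℕP.m<m+n (2 * R) (ℕ.s≤s ℕ.z≤n) ⟩
  2 * R + 3     ≤⟨ le ⟩
  3 * S + 0     ≡⟨ ℕP.+-identityʳ (3 * S) ⟩
  3 * S ∎)
  where open ℕP.≤-Reasoning

private
  exceed : ∀ k b {R} → k ℕ.< 3 * b → 3 + 2 * b * 3 ≤ R → k * (3 + 2 * b * 2) ℕ.< 2 * R * b
  exceed k b {R} k<3b le = ℕP.<-≤-trans (ℕP.+-cancelʳ-< (2 + 4 * b) _ _ (begin-strict
    k * (3 + 2 * b * 2) + (2 + 4 * b)       <⟨ ℕP.+-monoʳ-< (k * (3 + 2 * b * 2)) (ℕP.n<1+n (2 + 4 * b)) ⟩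
    k * (3 + 2 * b * 2) + (3 + 4 * b)       ≡⟨ solve (k ∷ b ∷ []) ⟩
    suc k * (3 + 2 * b * 2)                 ≤⟨ ℕP.*-monoˡ-≤ (3 + 2 * b * 2) k<3b ⟩
    3 * b * (3 + 2 * b * 2)                 ≤⟨ ℕP.m≤m+n _ (2 + b) ⟩
    3 * b * (3 + 2 * b * 2) + (2 + b)       ≡⟨ solve (b ∷ []) ⟩
    2 * (3 + 2 * b * 3) * b + (2 + 4 * b) ∎))
    (ℕP.*-monoˡ-≤ b (ℕP.*-monoʳ-≤ 2 le))
    where open ℕP.≤-Reasoning

-- A fraction k/b below 3 is at most 3 - 1/b, and the bouquet of 2b + 1 triangles has valence 3 -
-- 3/(4b + 3), which is larger because 3b < 4b + 3. For negative `q` a single triangle is enough.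
triangles-exceed : ∀ q → q ℚ.< + 3 / 1 →
  ∃ λ h → ∀ {R} → 3 + h * 3 ≤ R → q ℚ.< + (2 * R) / (3 + h * 2)
triangles-exceed q@(mkℚ -[1+ _ ] _ _) _ = 0 , λ {R} _ →
  ℚP.<-≤-trans {q} {ℚ.0ℚ} {+ (2 * R) / 3} (ℚP.negative⁻¹ q) (/-≤ {0} {1} {2 * R} {3} ℕ.z≤n)
triangles-exceed q@(mkℚ (+ k) d-1 _) q<3 = 2 * b , λ {R} le →
  subst (ℚ._< + (2 * R) / (3 + 2 * b * 2)) (ℚP.↥p/↧p≡p q)
    (/-< {k} {b} {2 * R} {3 + 2 * b * 2} (exceed k b k<3b le))
  where
  b = suc d-1
  k<3b : k ℕ.< 3 * b
  k<3b = ℤP.drop‿+<+ (subst₂ ℤ._<_ (ℤP.*-identityʳ (+ k)) (sym (ℤP.pos-* 3 b)) (ℚP.drop-*<* q<3))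

-- Edge bounds

valence : ∀ {g S A F} → Map g S A F → ℚ
valence M = Vr (toPolGraph M)

valence-mono : ∀ {g g′ S A A′ F F′} (M : Map g S A F) (N : Map g′ S A′ F′) →
  arMap M ≤ arMap N → valence M ℚ.≤ valence N
valence-mono {S = S} M N le = /-≤ {2 * arMap M} {S} {2 * arMap N} {S}
  {{S-nz (toPolGraph M)}} {{S-nz (toPolGraph N)}} (ℕP.*-monoˡ-≤ S (ℕP.*-monoʳ-≤ 2 le))

noShortFace⇒2A+3≤3S+6g : ∀ {g S A F} (M : Map g S A (suc F)) → NoShortFace M → 2 * A + 3 ≤ 3 * S + 6 * g
noShortFace⇒2A+3≤3S+6g {g} {S} {A} {F} M long = ℕP.+-cancelʳ-≤ (A + 3) _ _ (begin
  2 * A + 3 + (A + 3)               ≡⟨ solve (A ∷ []) ⟩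
  3 * (A + 2)                       ≡⟨ cong (3 *_) (Map.euler M) ⟨
  3 * (S + suc F + 2 * g)           ≡⟨ solve (S ∷ F ∷ g ∷ []) ⟩
  3 * S + 6 * g + (F * 3 + 3)       ≤⟨ ℕP.+-monoʳ-≤ (3 * S + 6 * g) (ℕP.+-monoˡ-≤ 3 (3F≤A M long)) ⟩
  3 * S + 6 * g + (A + 3) ∎)
  where open ℕP.≤-Reasoning

2A+3≤⇒A≤ : ∀ {A n} → 2 * A + 3 ≤ n → A ≤ n
2A+3≤⇒A≤ {A} le = ℕP.≤-trans (ℕP.≤-trans (ℕP.m≤m+n A (A + 0)) (ℕP.m≤m+n (2 * A) 3)) le

-- The face count does not cover a map whose reduction stopped at one edge: for a loop on the sphere
-- the inequality fails with A in place of R. It holds for R, since a graph with one vertex has no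
-- reduced edge.
one-edge-bound : ∀ {S R} g → 1 ≤ S → R ≤ 1 → R + (R + S) ≤ S * S → 2 * R + 3 ≤ 3 * S + 6 * g
one-edge-bound {suc zero} {zero}  g _ _ _ = ℕP.m≤m+n 3 (6 * g)
one-edge-bound {suc zero} {suc R} g _ _ le with ℕ.s≤s le′ ← le = contradiction le′ (ℕP.m+1+n≢0 R ∘ ℕP.n≤0⇒n≡0)
one-edge-bound {suc (suc S)} {R}  g _ R≤1 _ =
  ℕP.≤-trans (ℕP.+-monoˡ-≤ 3 (ℕP.*-monoʳ-≤ 2 R≤1))
    (ℕP.≤-trans (ℕP.≤-trans (ℕP.m≤m+n 5 1) (ℕP.*-monoʳ-≤ 3 (ℕP.m≤m+n 2 S))) (ℕP.m≤m+n (3 * suc (suc S)) (6 * g)))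

1≤S : ∀ {g S A F} → Map g S A F → 1 ≤ S
1≤S M = ℕ.>-nonZero⁻¹ _ {{S-nz (toPolGraph M)}}

module _ {g S A F : ℕ} (M : Map g S A F) where
  open Reduced (reduce M)

  private
    bounds : A′ ≤ 1 ⊎ NoShortFace map → 2 * arMap map + 3 ≤ 3 * S + 6 * g × A′ ≤ 3 * S + 6 * g
    bounds (inj₁ A′≤1) =
      one-edge-bound g (1≤S M) (ℕP.≤-trans Ar≤A A′≤1) 2Ar+S≤S² ,
      ℕP.≤-trans A′≤1 (ℕP.≤-trans (1≤S M) (ℕP.≤-trans (ℕP.m≤m+n S (2 * S)) (ℕP.m≤m+n (3 * S) (6 * g))))
      where open ReducedEdges (toPolGraph map)
    bounds (inj₂ long) =
      ℕP.≤-trans (ℕP.+-monoˡ-≤ 3 (ℕP.*-monoʳ-≤ 2 Ar≤A)) le , 2A+3≤⇒A≤ le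
      where
      open ReducedEdges (toPolGraph map)
      le : 2 * A′ + 3 ≤ 3 * S + 6 * g
      le = noShortFace⇒2A+3≤3S+6g map long

  reduced-A≤ : A′ ≤ 3 * S + 6 * g
  reduced-A≤ = proj₂ (bounds short)

  2Ar+3≤3S+6g : 2 * arMap M + 3 ≤ 3 * S + 6 * g
  2Ar+3≤3S+6g = ℕP.≤-trans (ℕP.+-monoˡ-≤ 3 (ℕP.*-monoʳ-≤ 2 more)) (proj₁ (bounds short))

F≤A+2 : ∀ {g S A F} → Map g S A F → F ≤ A + 2
F≤A+2 {g} {S} {A} {F} M = subst (F ≤_) (Map.euler M)
  (ℕP.≤-trans (ℕP.m≤n+m F S) (ℕP.m≤m+n (S + F) (2 * g)))

-- Finite search

record SomeMap (g : ℕ) : Set where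
  constructor someMap
  field
    {vertices edges faces} : ℕ
    theMap : Map g vertices edges faces

  theValence : ℚ
  theValence = valence theMap

open SomeMap

-- The list holds maps rather than rationals, so that its maximum is the valence of an actual map.
Cover : ℕ → {X : Set} → (X → ℚ) → Set
Cover g v = Σ (List (SomeMap g)) λ Ns → ∀ x → Any (λ N → v x ℚ.≤ theValence N) Ns

module _ {g : ℕ} where

  cover-Σ : ∀ {n} {P : Fin n → Set} (v : ∀ i → P i → ℚ) → (∀ i → Cover g (v i)) → Cover g (uncurry v)
  cover-Σ v c = concat (tabulate (proj₁ ∘ c)) ,
    λ (i , p) → AnyP.concat⁺ (AnyP.tabulate⁺ i (proj₂ (c i) p))

  cover-via : ∀ {X Y : Set} {v : X → ℚ} {w : Y → ℚ} (h : X → Y) → (∀ x → v x ≡ w (h x)) →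
    Cover g w → Cover g v
  cover-via {w = w} h eq (Ns , c) = Ns , λ x →
    Any.map (λ {N} → subst (ℚ._≤ theValence N) (sym (eq x))) (c (h x))

module _ {A : ℕ} where

  encode : ∀ {n} → (Dart A → Fin n) → Fin (n ^ (A * 2))
  encode f = funToFin (f ∘ codeDart)

  decode : ∀ {n} → Fin (n ^ (A * 2)) → Dart A → Fin n
  decode c d = finToFun c (dartCode d)

  decode-encode : ∀ {n} (f : Dart A → Fin n) d → f d ≡ decode (encode f) d
  decode-encode f d = sym (trans (FinP.finToFun-funToFin (f ∘ codeDart) (dartCode d))
                                 (cong f (codeDart-dartCode d)))

  encodeMap : (Dart A → Dart A) → Fin ((A * 2) ^ (A * 2))
  encodeMap f = encode (dartCode ∘ f)

  decodeMap : Fin ((A * 2) ^ (A * 2)) → Dart A → Dart A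
  decodeMap c d = codeDart (decode c d)

  decodeMap-encodeMap : ∀ f d → f d ≡ decodeMap (encodeMap f) d
  decodeMap-encodeMap f d =
    trans (sym (codeDart-dartCode (f d))) (cong codeDart (decode-encode (dartCode ∘ f) d))

module _ (g S A F : ℕ) where

  -- Functions that agree at every dart need not be equal, so a map is not recovered from its code.
  -- The codes are enumerated instead: maps with one code have pointwise equal tails, hence the same
  -- adjacencies, and one of them bounds the valence of all.
  HasCode : Fin (S ^ (A * 2)) → Fin ((A * 2) ^ (A * 2)) → Fin (F ^ (A * 2)) → Fin F → Set
  HasCode t n f o = Σ (Map g S A F) λ M → let open Map M in
    encode tail ≡ t × encodeMap next ≡ n × encode face ≡ f × outer ≡ o

  codedValence : ∀ t n f o → HasCode t n f o → ℚ
  codedValence t n f o (M , _) = valence M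

  cover-code : ∀ t n f o → Cover g (codedValence t n f o)
  cover-code t n f o = from (laws? g (decode t) (decodeMap n) (decode f) o)
    where
    module _ (laws : Laws g {S} {A} {F} (decode t) (decodeMap n) (decode f) o) where
      N : Map g S A F
      N = fromLaws laws

      tail≗ : (M : Map g S A F) → encode (Map.tail M) ≡ t → ∀ d → Map.tail N d ≡ Map.tail M d
      tail≗ M eq d = trans (cong (λ c → decode c d) (sym eq)) (sym (decode-encode (Map.tail M) d))

      same : (M : Map g S A F) → encode (Map.tail M) ≡ t → arMap M ≤ arMap N
      same M eq = arMap-mono M N λ _ (e , adj) → let agree = cong₂ _,_ (tail≗ M eq (e , true)) (tail≗ M eq (e , false)) in
        e , Sum.map (trans agree) (trans agree) adj

    unlawful : ¬ Laws g (decode t) (decodeMap n) (decode f) o → ¬ HasCode t n f o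
    unlawful ¬laws (M , refl , refl , refl , refl) = ¬laws
      (laws-cong {g} (decode-encode (Map.tail M)) (decodeMap-encodeMap (Map.next M))
        (decode-encode (Map.face M)) (map-laws M))

    from : Dec (Laws g (decode t) (decodeMap n) (decode f) o) → Cover g (codedValence t n f o)
    from (yes laws) = someMap (N laws) ∷ [] , λ (M , eq , _) → here (valence-mono M (N laws) (same laws M eq))
    from (no ¬laws) = [] , λ c → contradiction c (unlawful ¬laws)

  cover-maps : Cover g (valence {g} {S} {A} {F})
  cover-maps = cover-via (λ M → _ , _ , _ , _ , M , refl , refl , refl , refl) (λ _ → refl)
    (cover-Σ _ λ t → cover-Σ _ λ n → cover-Σ _ λ f → cover-Σ (codedValence t n f) λ o → cover-code t n f o)

BoundedMap : (g a b c : ℕ) → Set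
BoundedMap g a b c = Σ (Fin a) λ i → Σ (Fin b) λ j → Σ (Fin c) λ k → Map g (toℕ i) (toℕ j) (toℕ k)

boundedValence : ∀ g a b c → BoundedMap g a b c → ℚ
boundedValence g a b c (_ , _ , _ , M) = valence M

cover-bounded : ∀ g a b c → Cover g (boundedValence g a b c)
cover-bounded g a b c =
  cover-Σ _ λ i → cover-Σ _ λ j → cover-Σ _ λ k → cover-maps g (toℕ i) (toℕ j) (toℕ k)

boundedMap : ∀ {g a b c S A F} (M : Map g S A F) → S ℕ.< a → A ℕ.< b → F ℕ.< c →
  ∃ λ (B : BoundedMap g a b c) → boundedValence g a b c B ≡ valence M
boundedMap {g} {a} {b} {c} M S<a A<b F<c = index (as-toℕ S<a) (as-toℕ A<b) (as-toℕ F<c) M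
  where
  as-toℕ : ∀ {m n} → m ℕ.< n → ∃ λ (i : Fin n) → toℕ i ≡ m
  as-toℕ m<n = Fin.fromℕ< m<n , FinP.toℕ-fromℕ< m<n
  index : ∀ {S A F} → (∃ λ (i : Fin a) → toℕ i ≡ S) → (∃ λ (j : Fin b) → toℕ j ≡ A) →
    (∃ λ (k : Fin c) → toℕ k ≡ F) → (M : Map g S A F) →
    ∃ λ (B : BoundedMap g a b c) → boundedValence g a b c B ≡ valence M
  index (i , refl) (j , refl) (k , refl) M = (i , j , k , M) , refl

-- Starting the maximum at `M₀` makes it defined for an empty list and bounds it below by the
-- valence of `M₀`.
best-of : ∀ {g} {X : Set} {v : X → ℚ} (M₀ : SomeMap g) → Cover g v →
  Σ (SomeMap g) λ N → theValence M₀ ℚ.≤ theValence N × (∀ x → v x ℚ.≤ theValence N)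
best-of {v = v} M₀ (Ns , covers) = argmax theValence M₀ Ns ,
  f[⊥]≤f[argmax] {f = theValence} M₀ Ns ,
  λ x → v≤f[argmax]⁺ {f = theValence} {v = v x} M₀ Ns (inj₂ (covers x))

-- A map with many vertices has small valence, and one with few vertices reduces to one of
-- finitely many.
attained : ∀ g {S₀ A₀ F₀} (M₀ : Map g S₀ A₀ F₀) bound →
  (∀ {S A F} (M : Map g S A F) → bound ≤ S → valence M ℚ.≤ valence M₀) →
  Σ (SomeMap g) λ N → valence M₀ ℚ.≤ theValence N ×
    (∀ {S A F} (M : Map g S A F) → valence M ℚ.≤ theValence N)
attained g M₀ bound many =
  extend (best-of (someMap M₀) (cover-bounded g bound (suc maxA) (suc (maxA + 2))))
  where
  maxA : ℕ
  -- Reduction leaves at most 3S + 6g edges, here with S below `bound`, and Euler's formula allows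
  -- at most two more faces than edges.
  maxA = 3 * bound + 6 * g

  Bounded : Set
  Bounded = BoundedMap g bound (suc maxA) (suc (maxA + 2))

  bv : Bounded → ℚ
  bv = boundedValence g bound (suc maxA) (suc (maxA + 2))

  few : ∀ {S A F} (M : Map g S A F) → S ℕ.< bound → A ≤ maxA → ∃ λ (B : Bounded) → bv B ≡ valence M
  few M S< A≤ = boundedMap M S< (ℕ.s≤s A≤) (ℕ.s≤s (ℕP.≤-trans (F≤A+2 M) (ℕP.+-monoˡ-≤ 2 A≤)))

  extend : (Σ (SomeMap g) λ N → valence M₀ ℚ.≤ theValence N × (∀ B → bv B ℚ.≤ theValence N)) →
    Σ (SomeMap g) λ N → valence M₀ ℚ.≤ theValence N ×
      (∀ {S A F} (M : Map g S A F) → valence M ℚ.≤ theValence N)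
  extend (N , initial , dominates) = N , initial , λ {S} M →
    Sum.[ (λ S< → ℚP.≤-trans {valence M} {valence (Reduced.map (reduce M))} {theValence N}
            (valence-mono M (Reduced.map (reduce M)) (Reduced.more (reduce M)))
            (let B , eq = few (Reduced.map (reduce M)) S< (ℕP.≤-trans (reduced-A≤ M)
                   (ℕP.+-monoˡ-≤ (6 * g) (ℕP.*-monoʳ-≤ 3 (ℕP.<⇒≤ S<))))
             in subst (ℚ._≤ theValence N) eq (dominates B)))
        , (λ S≥ → ℚP.≤-trans {valence M} {valence M₀} {theValence N} (many M S≥) initial)
        ]′ (ℕP.<-≤-connex S bound)

-- The bouquets and the theorem

cast : ∀ {g g′ S S′ A A′ F F′} → g ≡ g′ → S ≡ S′ → A ≡ A′ → F ≡ F′ →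
  Σ (Map g S A F) IsSimple → Σ (Map g′ S′ A′ F′) IsSimple
cast refl refl refl refl M = M

triangles : ∀ h → Σ (Map 0 (3 + h * 2) (3 + h * 3) (2 + h * 1)) IsSimple
triangles h = cast (trans (grow-≡ 0 0 h) (ℕP.*-zeroʳ h)) (grow-≡ 2 3 h) (grow-≡ 3 3 h) (grow-≡ 1 2 h)
  (bouquet triangle triangle-rooted triangle-simple h)

wheels : ∀ h → Σ (Map (suc h) (5 + h * 4) (8 + h * 8) (3 + h * 2)) IsSimple
wheels h = cast (trans (grow-≡ 1 1 h) (cong suc (ℕP.*-identityʳ h))) (grow-≡ 4 5 h) (grow-≡ 8 8 h) (grow-≡ 2 3 h)
  (bouquet wheel wheel-rooted wheel-simple h)

admissible-valence : ∀ {g} (P : ℚ → Set) → (∀ {S A F} (M : Map g S A F) → P (valence M)) →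
  ∀ G → Admissible g G → P (Vr G)
admissible-valence P h G adm =
  let _ , M , eq = admissible⇒map G adm
  in subst P (cong (λ R → _/_ (+ (2 * R)) (S G) {{S-nz G}}) eq) (h M)

planar-valence<3 : ∀ {S A F} (M : Map 0 S A F) → valence M < + 3 / 1
planar-valence<3 {S} M = ratio<3 {arMap M} {S} {{S-nz (toPolGraph M)}} (2Ar+3≤3S+6g M)

planar-valence-supremum : ∀ q → q < + 3 / 1 → ∃[ G ] (Admissible 0 G × q < Vr G)
planar-valence-supremum q q<3 = from-bouquet (triangles-exceed q q<3)
  where
  from-bouquet : (∃ λ h → ∀ {R} → 3 + h * 3 ≤ R → q < + (2 * R) / (3 + h * 2)) →
    ∃[ G ] (Admissible 0 G × q < Vr G)
  from-bouquet (h , exceeds) = graph (triangles h)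
    where
    graph : Σ (Map 0 (3 + h * 2) (3 + h * 3) (2 + h * 1)) IsSimple → ∃[ G ] (Admissible 0 G × q < Vr G)
    graph (M , M-simple) =
      toPolGraph M , toPolGraph-admissible M , exceeds {arMap M} (simple⇒A≤arMap M M-simple)

valence≤br : ∀ {g S A F} (M : Map g S A F) → 1 ≤ g → valence M ≤ℚ br g
valence≤br {g} {S} M 1≤g = ratio≤br g {S} {arMap M} {{S-nz (toPolGraph M)}} 1≤g 2Ar+S≤S² (2Ar+3≤3S+6g M)
  where open ReducedEdges (toPolGraph M)

-- The fraction is 4 (1 + 1/(3g))^(-1) for g ≥ 1, cleared of its inner denominator.
IsBest : ∀ {g} → SomeMap g → Set
IsBest {g} N = + (12 * g) / suc (3 * g) ≤ℚ theValence N
  × (∀ {S A F} (M : Map g S A F) → valence M ≤ℚ theValence N)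

best-map : ∀ h → Σ (SomeMap (suc h)) IsBest
best-map h = from-bouquet (wheels h)
  where
  from-bouquet : Σ (Map (suc h) (5 + h * 4) (8 + h * 8) (3 + h * 2)) IsSimple → Σ (SomeMap (suc h)) IsBest
  -- With g = h + 1 and S ≥ 6g (4g + 1), the excess 6g/S is at most 1/(4g + 1), and 3 + 1/(4g + 1) ≤
  -- 4 - 4/(4g + 1) because 4g + 1 ≥ 5.
  from-bouquet (M₀ , M₀-simple) = from-maximum (attained (suc h) M₀ (6 * suc h * (5 + h * 4)) λ {S} M large →
    many-vertices h {arMap M₀} {S} {arMap M} {{S-nz (toPolGraph M)}} enough (2Ar+3≤3S+6g M) large)
    where
    enough : 8 + h * 8 ≤ arMap M₀
    enough = simple⇒A≤arMap M₀ M₀-simple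

    from-maximum : (Σ (SomeMap (suc h)) λ N → valence M₀ ≤ℚ theValence N ×
      (∀ {S A F} (M : Map (suc h) S A F) → valence M ≤ℚ theValence N)) → Σ (SomeMap (suc h)) IsBest
    from-maximum (N , M₀≤N , best) = N ,
      ℚP.≤-trans {+ (12 * suc h) / suc (3 * suc h)} {valence M₀} {theValence N}
        (lower-bound h {arMap M₀} enough) M₀≤N ,
      best

IsOptimal : ℕ → PolGraph → Set
IsOptimal g G = Admissible g G
  × ((G' : PolGraph) → Admissible g G' → Vr G' ≤ℚ Vr G)
  × (+ (12 * g) / suc (3 * g) ≤ℚ Vr G)
  × (Vr G ≤ℚ br g)
  × LeB (br g) g

optimal-graph : ∀ g → 1 ≤ g → ∃ (IsOptimal g)
optimal-graph (suc h) 1≤g = from-best (best-map h)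
  where
  from-best : Σ (SomeMap (suc h)) IsBest → ∃ (IsOptimal (suc h))
  from-best (N , lower , best) =
    toPolGraph (theMap N) , toPolGraph-admissible (theMap N) ,
    admissible-valence (_≤ℚ theValence N) best ,
    lower , valence≤br (theMap N) 1≤g , br≤b (suc h) 1≤g

theorem1p10 : ((G : PolGraph) → Admissible 0 G → Vr G < + 3 / 1)
    × ((q : ℚ) → q < + 3 / 1 → ∃[ G ] (Admissible 0 G × q < Vr G))
    × ((g : ℕ) → 1 ≤ g →
    ∃[ G ] (Admissible g G
    × ((G' : PolGraph) → Admissible g G' → Vr G' ≤ℚ Vr G)
    × (+ (12 * g) / suc (3 * g) ≤ℚ Vr G)
    × (Vr G ≤ℚ br g)
    × LeB (br g) g))
theorem1p10 = admissible-valence (_< + 3 / 1) planar-valence<3 , planar-valence-supremum , optimal-graph
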